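{- Let $\alpha$ be a composition of $n$. Then $$\mathcal p_\alpha=\sum_{\beta\vDash n}(-1)^{\ell(\beta)-\ell(\alpha\vee\beta)}\mathcal Q_{\alpha(\alpha\vee\beta)}F_\beta,$$ where for compositions $\alpha,\beta$, $\mathcal Q_{\alpha\beta}$ is the number of $\ell(\beta)\times\ell(\alpha)$ matrices $(m_{ij})$ whose nonzero entries are the parts of $\alpha$ such that (1) $\sum_{j=1}^{\ell(\alpha)}m_{ij}=\beta_i$ for each row $i$; (2) the only nonzero entry in column $j$ is $\widetilde\alpha_j$; (3) the nonzero entries give $\alpha$ when read left to right and top to bottom; (4) the rightmost nonzero entry of row $i$ is right of the leftmost nonzero entry of row $i+1$.
   Context: Let $\mathbb N=\{1,2,\dots\}$. A composition $\alpha=\alpha_1\cdots\alpha_\ell$ of $n$ ($\alpha\vDash n$) is a sequence of positive integers summing to $n$, $\ell(\alpha)=\ell$; $\widetilde\alpha=\widetilde\alpha_1\cdots\widetilde\alpha_\ell$ is its parts sorted weakly decreasingly. $\mathrm{set}(\alpha)=\{\alpha_1,\alpha_1+\alpha_2,\dots,\alpha_1+\dots+\alpha_{\ell-1}\}\subseteq[n-1]$. $\gamma$ is a coarsening of $\alpha$, $\gamma\succcurlyeq\alpha$, if $\mathrm{set}(\gamma)\subseteq\mathrm{set}(\alpha)$. The join $\alpha\vee\beta$ of $\alpha,\beta\vDash n$ is the unique composition of $n$ such that $\gamma\succcurlyeq\alpha$ and $\gamma\succcurlyeq\beta$ iff $\gamma\succcurlyeq\alpha\vee\beta$. $F_\beta=\sum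 x_{i_1}\cdots x_{i_n}$ over $i_1\le\dots\le i_n$ with $i_j<i_{j+1}$ whenever $j\in\mathrm{set}(\beta)$. A labelling of a finite poset $P$ is an injective map $\gamma$ into a chain; a weight function is $w:P\to\mathbb N$. A $(P,\gamma)$-partition is $f:P\to\mathbb N$ with, for all $p<q$, $f(p)\le f(q)$ and $f(p)=f(q)\Rightarrow\gamma(p)<\gamma(q)$. $K_{(P,\gamma,w)}=\sum_f\prod_{u\in P}x_{f(u)}^{w(u)}$ over all $(P,\gamma)$-partitions. For a chain $u_1<\dots<u_\ell$, $\alpha(s,w)=(w(u_1),\dots,w(u_\ell))$. Let $\mathbb N_{\mathbb N}=\{a_k:a,k\in\mathbb N\}$ ordered by $a_k<b_l$ iff $a<b$, or $a=b$ and $k<l$; $\mathbb N_{\mathbb N}^*$ is its reverse. For $\widetilde\alpha=m^{r_m}\cdots1^{r_1}$, $P^{\widetilde\alpha}$ is the antichain on $\{a_k:1\le a\le m,1\le k\le r_a\}$ with $w(a_k)=a$ and labelling $\gamma$ the inclusion into $\mathbb N_{\mathbb N}^*$. The combinatorial power sum is $\mathcal p_\alpha=\sum_sK_{(s,\gamma,w)}$ over linear extensions $s$ of $P^{\widetilde\alpha}$ with $\alpha(s,w)=\alpha$. -}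

module Defs where

open import Data.Nat.Base using (ℕ; zero; suc; _+_; _∸_; _≤_; _≡ᵇ_; _<ᵇ_; _≤ᵇ_)
open import Data.Bool.Base using (Bool; true; false; _∧_; _∨_; not; if_then_else_)
open import Data.List.Base using (List; []; _∷_; [_]; map; concatMap; applyUpTo; upTo;
  filterᵇ; length; foldr; zip; concat)
open import Data.Nat.ListAction using (sum)
open import Data.Bool.ListAction using (all; any)
open import Data.List.Relation.Unary.All using (All)
open import Data.Product.Base using (_×_; _,_; proj₁; proj₂)
open import Data.Maybe.Base using (Maybe; just; nothing)
open import Data.Integer.Base as ℤ using (ℤ; +_; -[1+_])
open import Relation.Binary.PropositionalEquality using (_≡_)

private variable A : Set

one-to : ℕ → List ℕ
one-to m = applyUpTo suc m

seqs : ℕ → List A → List (List A)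
seqs zero    xs = [ [] ]
seqs (suc m) xs = concatMap (λ x → map (x ∷_) (seqs m xs)) xs

_==_ : List ℕ → List ℕ → Bool
[]       == []       = true
(x ∷ xs) == (y ∷ ys) = (x ≡ᵇ y) ∧ (xs == ys)
_        == _        = false

elemᵇ : ℕ → List ℕ → Bool
elemᵇ x xs = any (x ≡ᵇ_) xs

allPairs : (A → A → Bool) → List A → Bool
allPairs R []       = true
allPairs R (x ∷ xs) = all (R x) xs ∧ allPairs R xs

nth : ℕ → List ℕ → ℕ
nth _       []       = 0
nth zero    (x ∷ xs) = x
nth (suc k) (x ∷ xs) = nth k xs

sumℤ : List ℤ → ℤ
sumℤ = foldr ℤ._+_ (+ 0)

sign : ℕ → ℤ
sign k = -[1+ 0 ] ℤ.^ k

IsComposition : ℕ → List ℕ → Set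
IsComposition n α = All (λ a → 1 ≤ a) α × sum α ≡ n

compositions : ℕ → List (List ℕ)
compositions n =
  filterᵇ (λ β → sum β ≡ᵇ n) (concatMap (λ l → seqs l (one-to n)) (upTo (suc n)))

-- set(α) = {α₁, α₁+α₂, …, α₁+⋯+α_{ℓ-1}} (as an increasing list)
setOf : List ℕ → List ℕ
setOf []           = []
setOf (a ∷ [])     = []
setOf (a ∷ b ∷ r)  = a ∷ map (λ x → a + x) (setOf (b ∷ r))

-- the composition of n whose set is the increasing list S ⊆ [n-1]
fromSetAux : ℕ → ℕ → List ℕ → List ℕ
fromSetAux p n []      = [ n ∸ p ]
fromSetAux p n (s ∷ S) = (s ∸ p) ∷ fromSetAux s n S

fromSet : ℕ → List ℕ → List ℕ
fromSet zero    S = []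
fromSet (suc n) S = fromSetAux 0 (suc n) S

join : List ℕ → List ℕ → List ℕ
join α β = fromSet (sum α) (filterᵇ (λ s → elemᵇ s (setOf β)) (setOf α))

insertDesc : ℕ → List ℕ → List ℕ
insertDesc x []       = [ x ]
insertDesc x (y ∷ ys) = if y ≤ᵇ x then x ∷ y ∷ ys else y ∷ insertDesc x ys

sortDesc : List ℕ → List ℕ
sortDesc = foldr insertDesc []

-- Monomials: a list e = e₁ … e_k stands for x₁^{e₁} ⋯ x_k^{e_k}.
-- Given a list of (variable index , exponent) pairs with indices in 1..k,
-- decide whether their product is the monomial e.
isMonomial : List ℕ → List (ℕ × ℕ) → Bool
isMonomial e ps =
  all (λ ie → sum (map proj₂ (filterᵇ (λ p → proj₁ p ≡ᵇ proj₁ ie) ps)) ≡ᵇ proj₂ ie)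
      (zip (one-to (length e)) e)

-- element a_k is the pair (a , k); weight w(a_k) = a
Elt : Set
Elt = ℕ × ℕ

w : Elt → ℕ
w = proj₁

eqElt : Elt → Elt → Bool
eqElt (a , k) (b , l) = (a ≡ᵇ b) ∧ (k ≡ᵇ l)

mult : ℕ → List ℕ → ℕ
mult a α = length (filterᵇ (a ≡ᵇ_) α)

elems : List ℕ → List Elt
elems α = concatMap (λ a → map (a ,_) (one-to (mult a (sortDesc α)))) (one-to (sum α))

ltNN : Elt → Elt → Bool
ltNN (a , k) (b , l) = (a <ᵇ b) ∨ ((a ≡ᵇ b) ∧ (k <ᵇ l))

-- γ(u) < γ(v) in ℕ_ℕ^* (reverse order)
γlt : Elt → Elt → Bool
γlt u v = ltNN v u

countElt : Elt → List Elt → ℕ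
countElt x s = length (filterᵇ (eqElt x) s)

-- linear extensions of the antichain P^α̃, as chains u₁ < ⋯ < u_ℓ listing
-- every element exactly once
linExts : List ℕ → List (List Elt)
linExts α = filterᵇ (λ s → all (λ x → countElt x s ≡ᵇ 1) (elems α))
                    (seqs (length (elems α)) (elems α))

αsw : List Elt → List ℕ
αsw s = map w s

-- f (listed along the chain s) is an (s,γ)-partition
isChainPartition : List Elt → List ℕ → Bool
isChainPartition s f =
  allPairs (λ { (u , i) (v , j) → (i ≤ᵇ j) ∧ (not (i ≡ᵇ j) ∨ γlt u v) }) (zip s f)

coeffK : List Elt → List ℕ → ℕ
coeffK s e = length (filterᵇ
  (λ f → isChainPartition s f ∧ isMonomial e (zip f (map w s)))
  (seqs (length s) (one-to (length e))))

coeffP : List ℕ → List ℕ → ℕ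
coeffP α e = sum (map (λ s → coeffK s e) (filterᵇ (λ s → αsw s == α) (linExts α)))

-- i₁ ≤ ⋯ ≤ i_n with i_j < i_{j+1} whenever j ∈ S (positions counted from j)
adjOK : ℕ → List ℕ → List ℕ → Bool
adjOK j S (x ∷ y ∷ r) = (if elemᵇ j S then x <ᵇ y else x ≤ᵇ y) ∧ adjOK (suc j) S (y ∷ r)
adjOK j S _           = true

coeffF : List ℕ → List ℕ → ℕ
coeffF β e = length (filterᵇ
  (λ is → adjOK 1 (setOf β) is ∧ isMonomial e (map (_, 1) is))
  (seqs (sum β) (one-to (length e))))

nonzeroᵇ : ℕ → Bool
nonzeroᵇ x = not (x ≡ᵇ 0)

nzIdx : List ℕ → List ℕ
nzIdx row = map proj₁ (filterᵇ (λ p → nonzeroᵇ (proj₂ p)) (zip (upTo (length row)) row))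

firstM : List ℕ → Maybe ℕ
firstM []      = nothing
firstM (x ∷ _) = just x

lastM : List ℕ → Maybe ℕ
lastM []           = nothing
lastM (x ∷ [])     = just x
lastM (x ∷ y ∷ xs) = lastM (y ∷ xs)

rightOf : List ℕ → List ℕ → Bool
rightOf r r' with lastM (nzIdx r) | firstM (nzIdx r')
... | just a | just b = b <ᵇ a
... | _      | _      = false

consecRows : List (List ℕ) → Bool
consecRows (r ∷ r' ∷ rs) = rightOf r r' ∧ consecRows (r' ∷ rs)
consecRows _             = true

-- conditions (1)–(4) on an ℓ(β)×ℓ(α) matrix M, given as its list of rows
isQMatrix : List ℕ → List ℕ → List (List ℕ) → Bool
isQMatrix α β M =
  (map sum M == β)
  ∧ all (λ ja → filterᵇ nonzeroᵇ (map (nth (proj₁ ja)) M) == [ proj₂ ja ])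
        (zip (upTo (length α)) (sortDesc α))
  ∧ (concat (map (filterᵇ nonzeroᵇ) M) == α)
  ∧ consecRows M

-- 𝒬_{αβ}: all ℓ(β)×ℓ(α) matrices of naturals whose nonzero entries are parts
-- of α (hence entries ≤ |α|) satisfying (1)–(4)
Q : List ℕ → List ℕ → ℕ
Q α β = length (filterᵇ (isQMatrix α β)
  (seqs (length β) (seqs (length α) (upTo (suc (sum α))))))

module Submission where

-- Both sides are sums over the sequences σ of column indices of the linear
-- extensions s, the elements of P^α̃ being numbered in decreasing order of ℕ_ℕ.
-- The chain s forces a strict increase exactly at the descents of σ, so K_s
-- depends only on the composition δ(s) obtained by adding up the weights along
-- the maximal increasing runs of σ.  Cutting σ at these runs yields the rows of
-- a matrix, and 𝒬_{αδ} is the number of s with δ(s) = δ.  Finally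
-- K_s = Σ_{β : α ∨ β = δ(s)} (-1)^{ℓ(β)-ℓ(δ(s))} F_β, which factors over the
-- positions 1, …, n−1: a position in set(α) has its membership in set(β)
-- prescribed, and any other one contributes [x ≤ y] − [x < y] = [x = y].

open import Defs
open import Data.Nat.Base as ℕ using (ℕ; zero; suc; _+_; _∸_; _≤_; _<_; z≤n; s≤s; _≡ᵇ_; _<ᵇ_; _≤ᵇ_)
import Data.Nat.Properties as ℕ
open import Data.Nat.ListAction using (sum)
open import Data.Nat.ListAction.Properties using (sum-↭)
open import Data.Bool.Base using (Bool; true; false; _∧_; _∨_; not; if_then_else_; T)
open import Data.Bool.ListAction using (all)
open import Data.Bool.Properties using (∧-assoc; ∧-comm; ∧-zeroʳ)
open import Data.Unit.Base using (tt)
open import Data.Maybe.Base using (just; nothing)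
open import Data.List.Base using (List; []; _∷_; [_]; _++_; map; concat; concatMap; length; filterᵇ;
  zip; zipWith; upTo; applyUpTo; reverse)
open import Data.List.Properties using (map-∘; map-cong; map-++; concat-map; length-map;
  length-applyUpTo; unfold-reverse; ∷-injective; ∷-injectiveˡ; ∷-injectiveʳ)
open import Data.List.Membership.Propositional using (_∈_; _∉_)
open import Data.List.Membership.Propositional.Properties
  using (∈-map⁺; ∈-map⁻; ∈-++⁺ˡ; ∈-++⁺ʳ; ∈-++⁻; ∈-filter⁺; ∈-filter⁻; ∈-upTo⁺; ∈-upTo⁻; ∈-applyUpTo⁺; ∈-applyUpTo⁻)
open import Data.List.Membership.Propositional.Properties.WithK using (unique∧set⇒bag)
open import Data.List.Relation.Unary.Any using (here; there)
open import Data.List.Relation.Unary.All as All using (All; []; _∷_)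
open import Data.List.Relation.Unary.AllPairs as AllPairs using (AllPairs; []; _∷_)
import Data.List.Relation.Unary.AllPairs.Properties as AllPairs
open import Data.List.Relation.Unary.Unique.Propositional using (Unique)
import Data.List.Relation.Unary.Unique.Propositional.Properties as Unique
open import Data.List.Relation.Binary.BagAndSetEquality using (∼bag⇒↭)
open import Data.List.Relation.Binary.Permutation.Propositional
  using (_↭_; refl; prep; swap; trans; ↭-refl; ↭-trans; ↭-sym; ↭-prep; ↭-swap)
open import Data.List.Relation.Binary.Permutation.Propositional.Properties
  using (↭-length; ↭-reverse; All-resp-↭; ∈-resp-↭; filter-↭; map⁺)
open import Data.List.Relation.Binary.Pointwise using (Pointwise; []; _∷_)
open import Data.Integer.Base as ℤ using (ℤ; +_; _*_; -[1+_]) renaming (_+_ to _+ᶻ_)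
import Data.Integer.Properties as ℤ
open import Data.Integer.Solver using (module +-*-Solver)
open import Data.Product.Base using (_×_; _,_; proj₁; proj₂; ∃-syntax)
open import Data.Sum.Base using (_⊎_; inj₁; inj₂)
open import Function.Base using (_∘_)
open import Function.Bundles using (mk⇔)
open import Relation.Binary.Definitions using (tri<; tri≈; tri>)
open import Relation.Binary.PropositionalEquality
  using (_≡_; _≢_; _≗_; refl; sym; cong; cong₂; subst; module ≡-Reasoning)
import Relation.Binary.PropositionalEquality as ≡
open import Relation.Nullary using (¬_; Dec; yes; no; contradiction)
open import Relation.Nullary.Decidable using (T?)

-- The identity of power series is proved coefficient by coefficient. Fixing the exponent list `e`
-- bounds all variable indices by `length e`, so every coefficient is a finite sum of 0/1 indicators
-- `ι` in the integers. The obstacle is that `K_s` counts sequences of ℓ(α) values whereas `F_β`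
-- counts sequences of n indices. Cancellation bridges the gap: the sequences of n indices that
-- survive it are constant on the blocks of α, hence carry one value per part. Bits are used for
-- compositions because set(α∨β) is the intersection of set(α) and set(β). The join becomes bitwise
-- conjunction, the sum over β a sum over independent bits, and the exponent ℓ(β)-ℓ(α∨β) the number
-- of elements of set(β) outside set(α), so that the sign also splits over positions. Descents
-- appear because γ lands in the reverse of ℕ_ℕ while the columns are numbered from the largest
-- element down: a larger column index means a larger label. The case n = 0 stands apart, since bit
-- sequences encode only nonempty compositions.

private variable A B C : Set

-- Finite sums and enumerations

ι : Bool → ℤ
ι true  = + 1
ι false = + 0

∑ : List A → (A → ℤ) → ℤ
∑ xs f = sumℤ (map f xs)

ι-∧ : ∀ a b → ι (a ∧ b) ≡ ι a * ι b
ι-∧ true  b = sym (ℤ.*-identityˡ (ι b))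
ι-∧ false b = sym (ℤ.*-zeroˡ (ι b))

∑-cong : ∀ (xs : List A) {f g : A → ℤ} → f ≗ g → ∑ xs f ≡ ∑ xs g
∑-cong xs eq = cong sumℤ (map-cong eq xs)

∑-cong-∈ : ∀ (xs : List A) {f g : A → ℤ} → (∀ x → x ∈ xs → f x ≡ g x) → ∑ xs f ≡ ∑ xs g
∑-cong-∈ []       eq = refl
∑-cong-∈ (x ∷ xs) eq = cong₂ _+ᶻ_ (eq x (here refl)) (∑-cong-∈ xs (λ y y∈ → eq y (there y∈)))

∑-map : ∀ (h : A → B) xs (f : B → ℤ) → ∑ (map h xs) f ≡ ∑ xs (f ∘ h)
∑-map h xs f = cong sumℤ (sym (map-∘ xs))

∑-++ : ∀ (xs ys : List A) (f : A → ℤ) → ∑ (xs ++ ys) f ≡ ∑ xs f +ᶻ ∑ ys f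
∑-++ []       ys f = sym (ℤ.+-identityˡ _)
∑-++ (x ∷ xs) ys f = ≡.trans (cong (f x +ᶻ_) (∑-++ xs ys f)) (sym (ℤ.+-assoc (f x) _ _))

∑-concatMap : ∀ (g : A → List B) xs (f : B → ℤ) → ∑ (concatMap g xs) f ≡ ∑ xs (λ x → ∑ (g x) f)
∑-concatMap g []       f = refl
∑-concatMap g (x ∷ xs) f =
  ≡.trans (∑-++ (g x) (concatMap g xs) f) (cong (∑ (g x) f +ᶻ_) (∑-concatMap g xs f))

∑-↭ : ∀ {xs ys : List A} → xs ↭ ys → ∀ (f : A → ℤ) → ∑ xs f ≡ ∑ ys f
∑-↭ refl         f = refl
∑-↭ (prep x p)   f = cong (f x +ᶻ_) (∑-↭ p f)
∑-↭ (swap {xs} {ys} x y p) f = begin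
  f x +ᶻ (f y +ᶻ ∑ xs f) ≡⟨ sym (ℤ.+-assoc (f x) (f y) _) ⟩
  f x +ᶻ f y +ᶻ ∑ xs f   ≡⟨ cong₂ _+ᶻ_ (ℤ.+-comm (f x) (f y)) (∑-↭ p f) ⟩
  f y +ᶻ f x +ᶻ ∑ ys f   ≡⟨ ℤ.+-assoc (f y) (f x) _ ⟩
  f y +ᶻ (f x +ᶻ ∑ ys f) ∎
  where open ≡-Reasoning
∑-↭ (trans p q)  f = ≡.trans (∑-↭ p f) (∑-↭ q f)

∑-zero : ∀ (xs : List A) → ∑ xs (λ _ → + 0) ≡ + 0
∑-zero []       = refl
∑-zero (x ∷ xs) = ≡.trans (ℤ.+-identityˡ _) (∑-zero xs)

interchange : ∀ a b c d → (a +ᶻ b) +ᶻ (c +ᶻ d) ≡ (a +ᶻ c) +ᶻ (b +ᶻ d)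
interchange a b c d = begin
  (a +ᶻ b) +ᶻ (c +ᶻ d) ≡⟨ ℤ.+-assoc a b _ ⟩
  a +ᶻ (b +ᶻ (c +ᶻ d)) ≡⟨ cong (a +ᶻ_) (sym (ℤ.+-assoc b c d)) ⟩
  a +ᶻ ((b +ᶻ c) +ᶻ d) ≡⟨ cong (λ z → a +ᶻ (z +ᶻ d)) (ℤ.+-comm b c) ⟩
  a +ᶻ ((c +ᶻ b) +ᶻ d) ≡⟨ cong (a +ᶻ_) (ℤ.+-assoc c b d) ⟩
  a +ᶻ (c +ᶻ (b +ᶻ d)) ≡⟨ sym (ℤ.+-assoc a c _) ⟩
  (a +ᶻ c) +ᶻ (b +ᶻ d) ∎
  where open ≡-Reasoning

∑-+ : ∀ (xs : List A) (f g : A → ℤ) → ∑ xs (λ x → f x +ᶻ g x) ≡ ∑ xs f +ᶻ ∑ xs g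
∑-+ []       f g = refl
∑-+ (x ∷ xs) f g =
  ≡.trans (cong (f x +ᶻ g x +ᶻ_) (∑-+ xs f g)) (interchange (f x) (g x) _ _)

∑-swap : ∀ (xs : List A) (ys : List B) (f : A → B → ℤ) →
         ∑ xs (λ x → ∑ ys (f x)) ≡ ∑ ys (λ y → ∑ xs (λ x → f x y))
∑-swap []       ys f = sym (∑-zero ys)
∑-swap (x ∷ xs) ys f =
  ≡.trans (cong (∑ ys (f x) +ᶻ_) (∑-swap xs ys f)) (sym (∑-+ ys (f x) _))

∑-*ˡ : ∀ k (xs : List A) (f : A → ℤ) → ∑ xs (λ x → k * f x) ≡ k * ∑ xs f
∑-*ˡ k []       f = sym (ℤ.*-zeroʳ k)
∑-*ˡ k (x ∷ xs) f =
  ≡.trans (cong (k * f x +ᶻ_) (∑-*ˡ k xs f)) (sym (ℤ.*-distribˡ-+ k (f x) _))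

∑-*ʳ : ∀ k (xs : List A) (f : A → ℤ) → ∑ xs (λ x → f x * k) ≡ ∑ xs f * k
∑-*ʳ k xs f = ≡.trans (∑-cong xs (λ x → ℤ.*-comm (f x) k))
                      (≡.trans (∑-*ˡ k xs f) (ℤ.*-comm k _))

∑-filter : ∀ (p : A → Bool) xs (f : A → ℤ) → ∑ (filterᵇ p xs) f ≡ ∑ xs (λ x → ι (p x) * f x)
∑-filter p []       f = refl
∑-filter p (x ∷ xs) f with p x
... | true  = cong₂ _+ᶻ_ (sym (ℤ.*-identityˡ (f x))) (∑-filter p xs f)
... | false = begin
  ∑ (filterᵇ p xs) f                               ≡⟨ ∑-filter p xs f ⟩
  ∑ xs (λ y → ι (p y) * f y)                       ≡⟨ sym (ℤ.+-identityˡ _) ⟩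
  + 0 +ᶻ ∑ xs (λ y → ι (p y) * f y)                ≡⟨ cong (_+ᶻ ∑ xs (λ y → ι (p y) * f y)) (sym (ℤ.*-zeroˡ (f x))) ⟩
  + 0 * f x +ᶻ ∑ xs (λ y → ι (p y) * f y)          ∎
  where open ≡-Reasoning

+-length-filter : ∀ (p : A → Bool) xs → + length (filterᵇ p xs) ≡ ∑ xs (ι ∘ p)
+-length-filter p []       = refl
+-length-filter p (x ∷ xs) with p x
... | true  = ≡.trans (ℤ.pos-+ 1 _) (cong (+ 1 +ᶻ_) (+-length-filter p xs))
... | false = ≡.trans (+-length-filter p xs) (sym (ℤ.+-identityˡ _))

+-sum-map : ∀ (g : A → ℕ) xs → + sum (map g xs) ≡ ∑ xs (λ x → + g x)
+-sum-map g []       = refl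
+-sum-map g (x ∷ xs) = ≡.trans (ℤ.pos-+ (g x) _) (cong (+ g x +ᶻ_) (+-sum-map g xs))

∑-seqs : ∀ m (xs : List A) (f : List A → ℤ) →
         ∑ (seqs (suc m) xs) f ≡ ∑ xs (λ x → ∑ (seqs m xs) (λ s → f (x ∷ s)))
∑-seqs m xs f = ≡.trans (∑-concatMap _ xs f) (∑-cong xs (λ x → ∑-map (x ∷_) (seqs m xs) f))

∑-seqs-↭ : ∀ m {xs ys : List A} → xs ↭ ys → ∀ f → ∑ (seqs m xs) f ≡ ∑ (seqs m ys) f
∑-seqs-↭ zero    p f = refl
∑-seqs-↭ (suc m) {xs} {ys} p f = begin
  ∑ (seqs (suc m) xs) f                          ≡⟨ ∑-seqs m xs f ⟩
  ∑ xs (λ x → ∑ (seqs m xs) (λ s → f (x ∷ s)))   ≡⟨ ∑-↭ p _ ⟩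
  ∑ ys (λ x → ∑ (seqs m xs) (λ s → f (x ∷ s)))   ≡⟨ ∑-cong ys (λ x → ∑-seqs-↭ m p _) ⟩
  ∑ ys (λ x → ∑ (seqs m ys) (λ s → f (x ∷ s)))   ≡⟨ sym (∑-seqs m ys f) ⟩
  ∑ (seqs (suc m) ys) f                          ∎
  where open ≡-Reasoning

∑-seqs-map : ∀ m (h : A → B) xs f → ∑ (seqs m (map h xs)) f ≡ ∑ (seqs m xs) (λ s → f (map h s))
∑-seqs-map zero    h xs f = refl
∑-seqs-map (suc m) h xs f = begin
  ∑ (seqs (suc m) (map h xs)) f
    ≡⟨ ∑-seqs m (map h xs) f ⟩
  ∑ (map h xs) (λ y → ∑ (seqs m (map h xs)) (λ s → f (y ∷ s)))
    ≡⟨ ∑-map h xs _ ⟩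
  ∑ xs (λ x → ∑ (seqs m (map h xs)) (λ s → f (h x ∷ s)))
    ≡⟨ ∑-cong xs (λ x → ∑-seqs-map m h xs _) ⟩
  ∑ xs (λ x → ∑ (seqs m xs) (λ s → f (h x ∷ map h s)))
    ≡⟨ sym (∑-seqs m xs _) ⟩
  ∑ (seqs (suc m) xs) (λ s → f (map h s)) ∎
  where open ≡-Reasoning

∈-concatMap⁺ : ∀ (g : A → List B) {xs x y} → x ∈ xs → y ∈ g x → y ∈ concatMap g xs
∈-concatMap⁺ g             (here refl) y∈ = ∈-++⁺ˡ y∈
∈-concatMap⁺ g {x′ ∷ xs}   (there x∈)  y∈ = ∈-++⁺ʳ (g x′) (∈-concatMap⁺ g x∈ y∈)

∈-concatMap⁻ : ∀ (g : A → List B) xs {y} → y ∈ concatMap g xs → ∃[ x ] x ∈ xs × y ∈ g x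
∈-concatMap⁻ g (x ∷ xs) y∈ with ∈-++⁻ (g x) y∈
... | inj₁ p = x , here refl , p
... | inj₂ p with ∈-concatMap⁻ g xs p
... | x′ , x′∈ , q = x′ , there x′∈ , q

concatMap-unique : ∀ (g : A → List B) {xs} → Unique xs → (∀ x → Unique (g x)) →
  (∀ {x x′ y} → y ∈ g x → y ∈ g x′ → x ≡ x′) → Unique (concatMap g xs)
concatMap-unique g []            ug disj = []
concatMap-unique g {x ∷ xs} (x∉ ∷ uxs) ug disj =
  Unique.++⁺ (ug x) (concatMap-unique g uxs ug disj)
    λ { (y∈gx , y∈) → let (x′ , x′∈ , y∈gx′) = ∈-concatMap⁻ g xs y∈ in
        All.lookup x∉ x′∈ (disj y∈gx y∈gx′) }

∈-seqs⁺ : ∀ {xs : List A} {s} → All (_∈ xs) s → s ∈ seqs (length s) xs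
∈-seqs⁺ []         = here refl
∈-seqs⁺ (x∈ ∷ s⊆) = ∈-concatMap⁺ _ x∈ (∈-map⁺ (_ ∷_) (∈-seqs⁺ s⊆))

∈-seqs⁻ : ∀ m {xs : List A} {s} → s ∈ seqs m xs → length s ≡ m × All (_∈ xs) s
∈-seqs⁻ zero    (here refl) = refl , []
∈-seqs⁻ (suc m) {xs} s∈ with ∈-concatMap⁻ _ xs s∈
... | x , x∈ , s∈′ with ∈-map⁻ (x ∷_) s∈′
... | s , s∈″ , refl with ∈-seqs⁻ m s∈″
... | len , s⊆ = cong suc len , x∈ ∷ s⊆

seqs-unique : ∀ m {xs : List A} → Unique xs → Unique (seqs m xs)
seqs-unique zero    u = [] ∷ []
seqs-unique (suc m) {xs} u = concatMap-unique _ u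
  (λ x → Unique.map⁺ (λ eq → proj₂ (∷-injective eq)) (seqs-unique m u)) head-eq
  where
  head-eq : ∀ {x x′ y} → y ∈ map (x ∷_) (seqs m xs) → y ∈ map (x′ ∷_) (seqs m xs) → x ≡ x′
  head-eq {x} {x′} p q with ∈-map⁻ (x ∷_) p | ∈-map⁻ (x′ ∷_) q
  ... | _ , _ , refl | _ , _ , refl = refl

unique∧set⇒↭ : ∀ {xs ys : List A} → Unique xs → Unique ys →
  (∀ {x} → x ∈ xs → x ∈ ys) → (∀ {x} → x ∈ ys → x ∈ xs) → xs ↭ ys
unique∧set⇒↭ u v to from = ∼bag⇒↭ (unique∧set⇒bag u v (mk⇔ to from))

map-unique : ∀ (f : A → B) {xs} → (∀ {x y} → x ∈ xs → y ∈ xs → f x ≡ f y → x ≡ y) →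
             Unique xs → Unique (map f xs)
map-unique f inj []       = []
map-unique f {x ∷ xs} inj (x∉ ∷ u) =
  All.tabulate (λ y∈ eq → let (z , z∈ , y≡) = ∈-map⁻ f y∈ in
    All.lookup x∉ z∈ (inj (here refl) (there z∈) (≡.trans eq y≡)))
  ∷ map-unique f (λ x∈ y∈ → inj (there x∈) (there y∈)) u

-- The inverse laws are required only on listed elements, because the maps between matrices and
-- index sequences invert each other only on valid ones.
bijection⇒length : ∀ {xs : List A} {ys : List B} → Unique xs → Unique ys →
  (f : A → B) (g : B → A) →
  (∀ {x} → x ∈ xs → f x ∈ ys) → (∀ {y} → y ∈ ys → g y ∈ xs) →
  (∀ {x} → x ∈ xs → g (f x) ≡ x) → (∀ {y} → y ∈ ys → f (g y) ≡ y) →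
  length xs ≡ length ys
bijection⇒length {xs = xs} {ys} u v f g to from gf fg =
  ≡.trans (sym (length-map f xs)) (↭-length (unique∧set⇒↭ (map-unique f inj u) v fwd bwd))
  where
  inj : ∀ {x y} → x ∈ xs → y ∈ xs → f x ≡ f y → x ≡ y
  inj x∈ y∈ eq = ≡.trans (sym (gf x∈)) (≡.trans (cong g eq) (gf y∈))
  fwd : ∀ {y} → y ∈ map f xs → y ∈ ys
  fwd y∈ with ∈-map⁻ f y∈
  ... | x , x∈ , refl = to x∈
  bwd : ∀ {y} → y ∈ ys → y ∈ map f xs
  bwd {y} y∈ = subst (_∈ map f xs) (fg y∈) (∈-map⁺ f (from y∈))

-- Compositions as bit sequences

T⇒≡ : ∀ {b} → T b → b ≡ true
T⇒≡ {true} _ = refl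

≡⇒T : ∀ {b} → b ≡ true → T b
≡⇒T refl = tt

¬T⇒≡ : ∀ {b} → ¬ T b → b ≡ false
¬T⇒≡ {false} _ = refl
¬T⇒≡ {true}  n = contradiction tt n

<ᵇ-true : ∀ {m n} → m < n → (m <ᵇ n) ≡ true
<ᵇ-true = T⇒≡ ∘ ℕ.<⇒<ᵇ

<ᵇ-false : ∀ {m n} → n ≤ m → (m <ᵇ n) ≡ false
<ᵇ-false n≤m = ¬T⇒≡ (λ t → ℕ.<⇒≱ (ℕ.<ᵇ⇒< _ _ t) n≤m)

≤ᵇ-true : ∀ {m n} → m ≤ n → (m ≤ᵇ n) ≡ true
≤ᵇ-true = T⇒≡ ∘ ℕ.≤⇒≤ᵇ

≤ᵇ-false : ∀ {m n} → n < m → (m ≤ᵇ n) ≡ false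
≤ᵇ-false n<m = ¬T⇒≡ (λ t → ℕ.<⇒≱ n<m (ℕ.≤ᵇ⇒≤ _ _ t))

≡ᵇ-refl : ∀ n → (n ≡ᵇ n) ≡ true
≡ᵇ-refl n = T⇒≡ (ℕ.≡⇒≡ᵇ n n refl)

≡ᵇ-false : ∀ {m n} → m ≢ n → (m ≡ᵇ n) ≡ false
≡ᵇ-false m≢n = ¬T⇒≡ (λ t → m≢n (ℕ.≡ᵇ⇒≡ _ _ t))

≡ᵇ-true⇒≡ : ∀ {m n} → (m ≡ᵇ n) ≡ true → m ≡ n
≡ᵇ-true⇒≡ = ℕ.≡ᵇ⇒≡ _ _ ∘ ≡⇒T

<ᵇ-true⇒< : ∀ {m n} → (m <ᵇ n) ≡ true → m < n
<ᵇ-true⇒< = ℕ.<ᵇ⇒< _ _ ∘ ≡⇒T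

filterᵇ-cong : ∀ {p q : A → Bool} {xs} → All (λ x → p x ≡ q x) xs → filterᵇ p xs ≡ filterᵇ q xs
filterᵇ-cong [] = refl
filterᵇ-cong {p = p} {q} {x ∷ xs} (eq ∷ eqs) with p x | q x
filterᵇ-cong {xs = x ∷ xs} (refl ∷ eqs) | true  | .true  = cong (x ∷_) (filterᵇ-cong eqs)
filterᵇ-cong {xs = x ∷ xs} (refl ∷ eqs) | false | .false = filterᵇ-cong eqs

-- A list b₁ … b_m of bits encodes the subset {j | b_j = true} of [m]; grp 1 b
-- is the composition of m + 1 with that set, and in grp c b the block that is
-- being read already has size c.
grp : ℕ → List Bool → List ℕ
grp c []          = c ∷ []
grp c (true  ∷ b) = c ∷ grp 1 b
grp c (false ∷ b) = grp (suc c) b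

posn : ℕ → List Bool → List ℕ
posn c []          = []
posn c (true  ∷ b) = c ∷ posn (suc c) b
posn c (false ∷ b) = posn (suc c) b

bits : List Bool
bits = true ∷ false ∷ []

infixr 6 _∩_
_∩_ : List Bool → List Bool → List Bool
_∩_ = zipWith _∧_

ones : List Bool → ℕ
ones []          = 0
ones (true  ∷ b) = suc (ones b)
ones (false ∷ b) = ones b

∩-length : ∀ a b → length b ≡ length a → length (a ∩ b) ≡ length a
∩-length []      []      eq = refl
∩-length (_ ∷ a) (_ ∷ b) eq = cong suc (∩-length a b (ℕ.suc-injective eq))

sum-grp : ∀ c b → sum (grp c b) ≡ c + length b
sum-grp c []          = refl
sum-grp c (true  ∷ b) = cong (λ z → c + z) (sum-grp 1 b)
sum-grp c (false ∷ b) = ≡.trans (sum-grp (suc c) b) (sym (ℕ.+-suc c (length b)))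

length-grp : ∀ c b → length (grp c b) ≡ suc (ones b)
length-grp c []          = refl
length-grp c (true  ∷ b) = cong suc (length-grp 1 b)
length-grp c (false ∷ b) = length-grp (suc c) b

grp-positive : ∀ c b → 1 ≤ c → All (1 ≤_) (grp c b)
grp-positive c []          1≤c = 1≤c ∷ []
grp-positive c (true  ∷ b) 1≤c = 1≤c ∷ grp-positive 1 b (s≤s z≤n)
grp-positive c (false ∷ b) 1≤c = grp-positive (suc c) b (s≤s z≤n)

grp-head : ∀ c b → ∃[ y ] ∃[ ys ] grp c b ≡ y ∷ ys × c ≤ y
grp-head c []          = c , [] , refl , ℕ.≤-refl
grp-head c (true  ∷ b) = c , grp 1 b , refl , ℕ.≤-refl
grp-head c (false ∷ b) with grp-head (suc c) b
... | y , ys , eq , c<y = y , ys , eq , ℕ.<⇒≤ c<y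

-- The counter is a block size in `grp` but an absolute position in `posn`. The two agree up to the
-- first true bit; after it `grp` restarts at 1, and the shift by `c` in `setOf` restores the
-- position.
setOf-grp : ∀ c b → setOf (grp c b) ≡ posn c b
setOf-grp c []          = refl
setOf-grp c (false ∷ b) = setOf-grp (suc c) b
setOf-grp c (true  ∷ b) = begin
  setOf (c ∷ grp 1 b)               ≡⟨ setOf-∷ (grp-head 1 b) ⟩
  c ∷ map (λ x → c + x) (setOf (grp 1 b)) ≡⟨ cong (λ z → c ∷ map (λ x → c + x) z) (setOf-grp 1 b) ⟩
  c ∷ map (λ x → c + x) (posn 1 b)  ≡⟨ cong (c ∷_) (map-posn 1 b) ⟩
  c ∷ posn (c + 1) b                ≡⟨ cong (λ k → c ∷ posn k b) (ℕ.+-comm c 1) ⟩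
  c ∷ posn (suc c) b                ∎
  where
  open ≡-Reasoning
  setOf-∷ : ∀ {α} → (∃[ y ] ∃[ ys ] α ≡ y ∷ ys × 1 ≤ y) →
            setOf (c ∷ α) ≡ c ∷ map (λ x → c + x) (setOf α)
  setOf-∷ (_ , _ , refl , _) = refl
  map-posn : ∀ k b → map (λ x → c + x) (posn k b) ≡ posn (c + k) b
  map-posn k []          = refl
  map-posn k (true  ∷ b) = cong (c + k ∷_) (≡.trans (map-posn (suc k) b) (cong (λ z → posn z b) (ℕ.+-suc c k)))
  map-posn k (false ∷ b) = ≡.trans (map-posn (suc k) b) (cong (λ z → posn z b) (ℕ.+-suc c k))

-- Here `p` is the last boundary passed, so the open block has size `c ∸ p`; `p ≤ c` keeps the
-- truncated subtraction exact.
fromSetAux-posn : ∀ {p} c b → p ≤ c → fromSetAux p (c + length b) (posn c b) ≡ grp (c ∸ p) b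
fromSetAux-posn {p} c [] p≤c = cong (λ n → [ n ∸ p ]) (ℕ.+-identityʳ c)
fromSetAux-posn {p} c (true ∷ b) p≤c = cong (c ∸ p ∷_) (begin
  fromSetAux c (c + suc (length b)) (posn (suc c) b) ≡⟨ cong (λ n → fromSetAux c n (posn (suc c) b)) (ℕ.+-suc c (length b)) ⟩
  fromSetAux c (suc c + length b) (posn (suc c) b)   ≡⟨ fromSetAux-posn (suc c) b (ℕ.n≤1+n c) ⟩
  grp (suc c ∸ c) b                                  ≡⟨ cong (λ k → grp k b) (ℕ.m+n∸n≡m 1 c) ⟩
  grp 1 b                                            ∎)
  where open ≡-Reasoning
fromSetAux-posn {p} c (false ∷ b) p≤c = begin
  fromSetAux p (c + suc (length b)) (posn (suc c) b) ≡⟨ cong (λ n → fromSetAux p n (posn (suc c) b)) (ℕ.+-suc c (length b)) ⟩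
  fromSetAux p (suc c + length b) (posn (suc c) b)   ≡⟨ fromSetAux-posn (suc c) b (ℕ.m≤n⇒m≤1+n p≤c) ⟩
  grp (suc c ∸ p) b                                  ≡⟨ cong (λ k → grp k b) (ℕ.+-∸-assoc 1 p≤c) ⟩
  grp (suc (c ∸ p)) b                                ∎
  where open ≡-Reasoning

posn-≥ : ∀ c b → All (c ≤_) (posn c b)
posn-≥ c []          = []
posn-≥ c (true  ∷ b) = ℕ.≤-refl ∷ All.map ℕ.<⇒≤ (posn-≥ (suc c) b)
posn-≥ c (false ∷ b) = All.map ℕ.<⇒≤ (posn-≥ (suc c) b)

elemᵇ-< : ∀ {j xs} → All (j <_) xs → elemᵇ j xs ≡ false
elemᵇ-< []           = refl
elemᵇ-< (j<x ∷ j<xs) = cong₂ _∨_ (≡ᵇ-false (ℕ.<⇒≢ j<x)) (elemᵇ-< j<xs)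

elemᵇ-posn-head : ∀ c b₀ b → elemᵇ c (posn c (b₀ ∷ b)) ≡ b₀
elemᵇ-posn-head c true  b rewrite ≡ᵇ-refl c = refl
elemᵇ-posn-head c false b = elemᵇ-< (posn-≥ (suc c) b)

elemᵇ-posn-tail : ∀ {c s} b₀ b → suc c ≤ s → elemᵇ s (posn c (b₀ ∷ b)) ≡ elemᵇ s (posn (suc c) b)
elemᵇ-posn-tail true  b c<s rewrite ≡ᵇ-false (ℕ.>⇒≢ c<s) = refl
elemᵇ-posn-tail false b c<s = refl

filter-posn : ∀ c a b → length b ≡ length a →
  filterᵇ (λ s → elemᵇ s (posn c b)) (posn c a) ≡ posn c (a ∩ b)
filter-posn c []      []       eq = refl
filter-posn c (a₀ ∷ a) (b₀ ∷ b) eq = go a₀ b₀ (elemᵇ-posn-head c b₀ b)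
  where
  rest : filterᵇ (λ s → elemᵇ s (posn c (b₀ ∷ b))) (posn (suc c) a) ≡ posn (suc c) (a ∩ b)
  rest = ≡.trans (filterᵇ-cong (All.map (λ {s} → elemᵇ-posn-tail b₀ b) (posn-≥ (suc c) a)))
                 (filter-posn (suc c) a b (ℕ.suc-injective eq))
  go : ∀ a₀ t → elemᵇ c (posn c (b₀ ∷ b)) ≡ t →
    filterᵇ (λ s → elemᵇ s (posn c (b₀ ∷ b))) (posn c (a₀ ∷ a)) ≡ posn c ((a₀ ∧ t) ∷ (a ∩ b))
  go false t     eq = rest
  go true  true  eq rewrite eq = cong (c ∷_) rest
  go true  false eq rewrite eq = rest

-- The set of the join is an intersection, hence a bitwise conjunction. A condition on the join with
-- α thereby becomes one condition per position.
join-grp : ∀ a b → length b ≡ length a → join (grp 1 a) (grp 1 b) ≡ grp 1 (a ∩ b)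
join-grp a b eq
  rewrite setOf-grp 1 a | setOf-grp 1 b | filter-posn 1 a b eq | sum-grp 1 a =
  ≡.trans (cong (λ n → fromSetAux 0 (suc n) (posn 1 (a ∩ b))) (sym (∩-length a b eq)))
          (fromSetAux-posn 1 (a ∩ b) z≤n)

-- Serves both sides: with the bits of β it is the condition on the n indices in `F_β`, with the
-- bits of `strict` the condition on the ℓ(α) values of a chain partition.
adjB : List Bool → ℕ → List ℕ → Bool
adjB (b ∷ bs) x (y ∷ ys) = (if b then x <ᵇ y else x ≤ᵇ y) ∧ adjB bs y ys
adjB _        _ _        = true

adjOK-cong : ∀ j {S S′} xs → (∀ i → j ≤ i → elemᵇ i S ≡ elemᵇ i S′) → adjOK j S xs ≡ adjOK j S′ xs
adjOK-cong j []           eq = refl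
adjOK-cong j (x ∷ [])     eq = refl
adjOK-cong j (x ∷ y ∷ xs) eq = cong₂ _∧_
  (cong (λ t → if t then x <ᵇ y else x ≤ᵇ y) (eq j ℕ.≤-refl))
  (adjOK-cong (suc j) (y ∷ xs) (λ i j<i → eq i (ℕ.<⇒≤ j<i)))

adjOK-posn : ∀ c b x xs → length xs ≡ length b → adjOK c (posn c b) (x ∷ xs) ≡ adjB b x xs
adjOK-posn c []       x []       eq = refl
adjOK-posn c (b₀ ∷ b) x (y ∷ ys) eq = cong₂ _∧_
  (cong (λ t → if t then x <ᵇ y else x ≤ᵇ y) (elemᵇ-posn-head c b₀ b))
  (≡.trans (adjOK-cong (suc c) (y ∷ ys) (λ i c<i → elemᵇ-posn-tail b₀ b c<i))
           (adjOK-posn (suc c) b y ys (ℕ.suc-injective eq)))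

-- The number of elements of set(β) outside set(α).
excess : List Bool → List Bool → ℕ
excess (false ∷ a) (true  ∷ b) = suc (excess a b)
excess (false ∷ a) (false ∷ b) = excess a b
excess (true  ∷ a) (_     ∷ b) = excess a b
excess _           _           = 0

ones-excess : ∀ a b → length b ≡ length a → ones b ≡ excess a b + ones (a ∩ b)
ones-excess []          []          eq = refl
ones-excess (false ∷ a) (true  ∷ b) eq = cong suc (ones-excess a b (ℕ.suc-injective eq))
ones-excess (false ∷ a) (false ∷ b) eq = ones-excess a b (ℕ.suc-injective eq)
ones-excess (true  ∷ a) (false ∷ b) eq = ones-excess a b (ℕ.suc-injective eq)
ones-excess (true  ∷ a) (true  ∷ b) eq =
  ≡.trans (cong suc (ones-excess a b (ℕ.suc-injective eq))) (sym (ℕ.+-suc _ _))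

-- By `ones-excess` the join never has more parts than β, so truncated subtraction gives the true
-- exponent of the sign.
length-∸-grp : ∀ a b → length b ≡ length a →
  length (grp 1 b) ∸ length (grp 1 (a ∩ b)) ≡ excess a b
length-∸-grp a b eq
  rewrite length-grp 1 b | length-grp 1 (a ∩ b) | ones-excess a b eq = ℕ.m+n∸n≡m (excess a b) (ones (a ∩ b))

eqB : List Bool → List Bool → Bool
eqB []          []          = true
eqB (true  ∷ d) (true  ∷ b) = eqB d b
eqB (false ∷ d) (false ∷ b) = eqB d b
eqB _           _           = false

-- At the first differing bit one list closes a block of size `c` while the block of the other grows
-- beyond `c`, so the heads differ. The comparison of compositions can thus be split bit by bit in
-- `signed-sum`.
grp-== : ∀ c d b → length d ≡ length b → (grp c d == grp c b) ≡ eqB d b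
grp-== c []          []          eq rewrite ≡ᵇ-refl c = refl
grp-== c (true  ∷ d) (true  ∷ b) eq rewrite ≡ᵇ-refl c = grp-== 1 d b (ℕ.suc-injective eq)
grp-== c (false ∷ d) (false ∷ b) eq = grp-== (suc c) d b (ℕ.suc-injective eq)
grp-== c (true  ∷ d) (false ∷ b) eq with grp-head (suc c) b
... | y , ys , e , c<y rewrite e | ≡ᵇ-false (ℕ.<⇒≢ c<y) = refl
grp-== c (false ∷ d) (true  ∷ b) eq with grp-head (suc c) d
... | y , ys , e , c<y rewrite e | ≡ᵇ-false (ℕ.>⇒≢ c<y) = refl

-- If a encodes set(α), then ref a ss encodes the coarsening of α that keeps the
-- i-th boundary of α exactly when the i-th entry of ss is true.
ref : List Bool → List Bool → List Bool
ref []          ss       = []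
ref (true  ∷ a) (s ∷ ss) = s ∷ ref a ss
ref (true  ∷ a) []       = false ∷ ref a []
ref (false ∷ a) ss       = false ∷ ref a ss

ref-length : ∀ a ss → length (ref a ss) ≡ length a
ref-length []          ss       = refl
ref-length (true  ∷ a) (s ∷ ss) = cong suc (ref-length a ss)
ref-length (true  ∷ a) []       = cong suc (ref-length a [])
ref-length (false ∷ a) ss       = cong suc (ref-length a ss)

-- The condition on n indices that survives the cancellation; the equalities off the boundaries of α
-- make each block constant.
adjRef : List Bool → List Bool → ℕ → List ℕ → Bool
adjRef (true  ∷ a) (s ∷ ss) x (y ∷ ys) = (if s then x <ᵇ y else x ≤ᵇ y) ∧ adjRef a ss y ys
adjRef (false ∷ a) ss       x (y ∷ ys) = (x ≡ᵇ y) ∧ adjRef a ss y ys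
adjRef _           _        _ _        = true

ι-≤-< : ∀ x y → ι (x ≤ᵇ y) +ᶻ -[1+ 0 ] * ι (x <ᵇ y) ≡ ι (x ≡ᵇ y)
ι-≤-< x y with ℕ.<-cmp x y
... | tri< x<y x≢y _ rewrite ≤ᵇ-true (ℕ.<⇒≤ x<y) | <ᵇ-true x<y | ≡ᵇ-false x≢y = refl
... | tri≈ _ refl _ rewrite ≤ᵇ-true (ℕ.≤-refl {x}) | <ᵇ-false (ℕ.≤-refl {x}) | ≡ᵇ-refl x = refl
... | tri> _ x≢y y<x rewrite ≤ᵇ-false y<x | <ᵇ-false (ℕ.<⇒≤ y<x) | ≡ᵇ-false x≢y = refl

-- Inclusion–exclusion, position by position: a boundary of α contributes the
-- single bit prescribed by ss, and any other position contributes
-- [x ≤ y] − [x < y] = [x = y].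
signed-sum : ∀ a ss x xs → length ss ≡ ones a → length xs ≡ length a →
  ∑ (seqs (length a) bits)
    (λ b → sign (excess a b) * (ι (eqB (ref a ss) (a ∩ b)) * ι (adjB b x xs)))
  ≡ ι (adjRef a ss x xs)
signed-sum [] [] x [] e e′ = refl
signed-sum (true ∷ a) (s ∷ ss) x (y ∷ ys) e e′ = begin
  ∑ (seqs (suc (length a)) bits) _
    ≡⟨ ∑-seqs (length a) bits _ ⟩
  ∑ bits (λ b₀ → ∑ bs (λ b → sign (excess a b) * (ι (eqB (s ∷ ref a ss) (b₀ ∷ (a ∩ b))) * ι (c b₀ ∧ adjB b y ys))))
    ≡⟨ select s ⟩
  ∑ bs (λ b → sign (excess a b) * (ι (eqB (ref a ss) (a ∩ b)) * ι (c s ∧ adjB b y ys)))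
    ≡⟨ ∑-cong bs (λ b → pull (sign (excess a b)) (ι (eqB (ref a ss) (a ∩ b))) (c s) (adjB b y ys)) ⟩
  ∑ bs (λ b → ι (c s) * F b)
    ≡⟨ ∑-*ˡ (ι (c s)) bs F ⟩
  ι (c s) * ∑ bs F
    ≡⟨ cong (ι (c s) *_) (signed-sum a ss y ys (ℕ.suc-injective e) (ℕ.suc-injective e′)) ⟩
  ι (c s) * ι (adjRef a ss y ys)
    ≡⟨ sym (ι-∧ (c s) _) ⟩
  ι (c s ∧ adjRef a ss y ys) ∎
  where
  open ≡-Reasoning
  bs = seqs (length a) bits
  c : Bool → Bool
  c t = if t then x <ᵇ y else x ≤ᵇ y
  F : List Bool → ℤ
  F b = sign (excess a b) * (ι (eqB (ref a ss) (a ∩ b)) * ι (adjB b y ys))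
  pull : ∀ k l t u → k * (l * ι (t ∧ u)) ≡ ι t * (k * (l * ι u))
  pull k l t u rewrite ι-∧ t u =
    solve 4 (λ k l t u → k :* (l :* (t :* u)) := t :* (k :* (l :* u))) refl k l (ι t) (ι u)
    where open +-*-Solver
  vanish : ∀ (G : List Bool → ℤ) (H : List Bool → ℤ) → ∑ bs (λ b → G b * (+ 0 * H b)) ≡ + 0
  vanish G H = ≡.trans (∑-cong bs (λ b → ≡.trans (cong (G b *_) (ℤ.*-zeroˡ (H b))) (ℤ.*-zeroʳ (G b)))) (∑-zero bs)
  -- Conjunction with a true bit of `a` leaves `b₀` as it is, so the test compares `b₀` with `s`,
  -- and the half of the sum with the other bit vanishes.
  select : ∀ s →
    ∑ bits (λ b₀ → ∑ bs (λ b → sign (excess a b) * (ι (eqB (s ∷ ref a ss) (b₀ ∷ (a ∩ b))) * ι (c b₀ ∧ adjB b y ys))))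
    ≡ ∑ bs (λ b → sign (excess a b) * (ι (eqB (ref a ss) (a ∩ b)) * ι (c s ∧ adjB b y ys)))
  select true rewrite vanish (λ b → sign (excess a b)) (λ b → ι (c false ∧ adjB b y ys)) = ℤ.+-identityʳ _
  select false rewrite vanish (λ b → sign (excess a b)) (λ b → ι (c true ∧ adjB b y ys)) =
    ≡.trans (ℤ.+-identityˡ _) (ℤ.+-identityʳ _)
signed-sum (false ∷ a) ss x (y ∷ ys) e e′ = begin
  ∑ (seqs (suc (length a)) bits) _
    ≡⟨ ∑-seqs (length a) bits _ ⟩
  ∑ bs (λ b → -[1+ 0 ] * sign (excess a b) * (E b * ι ((x <ᵇ y) ∧ adjB b y ys)))
    +ᶻ (∑ bs (λ b → sign (excess a b) * (E b * ι ((x ≤ᵇ y) ∧ adjB b y ys))) +ᶻ + 0)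
    ≡⟨ cong (λ z → ∑ bs (λ b → -[1+ 0 ] * sign (excess a b) * (E b * ι ((x <ᵇ y) ∧ adjB b y ys))) +ᶻ z) (ℤ.+-identityʳ _) ⟩
  ∑ bs (λ b → -[1+ 0 ] * sign (excess a b) * (E b * ι ((x <ᵇ y) ∧ adjB b y ys)))
    +ᶻ ∑ bs (λ b → sign (excess a b) * (E b * ι ((x ≤ᵇ y) ∧ adjB b y ys)))
    ≡⟨ sym (∑-+ bs _ _) ⟩
  ∑ bs (λ b → -[1+ 0 ] * sign (excess a b) * (E b * ι ((x <ᵇ y) ∧ adjB b y ys))
               +ᶻ sign (excess a b) * (E b * ι ((x ≤ᵇ y) ∧ adjB b y ys)))
    ≡⟨ ∑-cong bs (λ b → combine (sign (excess a b)) (E b) (adjB b y ys)) ⟩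
  ∑ bs (λ b → ι (x ≡ᵇ y) * F b)
    ≡⟨ ∑-*ˡ (ι (x ≡ᵇ y)) bs F ⟩
  ι (x ≡ᵇ y) * ∑ bs F
    ≡⟨ cong (ι (x ≡ᵇ y) *_) (signed-sum a ss y ys e (ℕ.suc-injective e′)) ⟩
  ι (x ≡ᵇ y) * ι (adjRef a ss y ys)
    ≡⟨ sym (ι-∧ (x ≡ᵇ y) _) ⟩
  ι ((x ≡ᵇ y) ∧ adjRef a ss y ys) ∎
  where
  open ≡-Reasoning
  bs = seqs (length a) bits
  E F : List Bool → ℤ
  E b = ι (eqB (ref a ss) (a ∩ b))
  F b = sign (excess a b) * (E b * ι (adjB b y ys))
  -- Off the boundaries of α neither value of the bit changes `a ∩ b`, so both halves share the
  -- factor `l`; the value true raises the excess by one, whence the coefficient -1.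
  combine : ∀ k l u →
    -[1+ 0 ] * k * (l * ι ((x <ᵇ y) ∧ u)) +ᶻ k * (l * ι ((x ≤ᵇ y) ∧ u)) ≡ ι (x ≡ᵇ y) * (k * (l * ι u))
  combine k l u rewrite ι-∧ (x <ᵇ y) u | ι-∧ (x ≤ᵇ y) u | sym (ι-≤-< x y) =
    solve 5 (λ k l lt le u →
      con -[1+ 0 ] :* k :* (l :* (lt :* u)) :+ k :* (l :* (le :* u))
      := (le :+ con -[1+ 0 ] :* lt) :* (k :* (l :* u))) refl k l (ι (x <ᵇ y)) (ι (x ≤ᵇ y)) (ι u)
    where open +-*-Solver

∑-select : ∀ {X : List ℕ} {x} → Unique X → x ∈ X → ∀ (f : ℕ → ℤ) → ∑ X (λ y → ι (x ≡ᵇ y) * f y) ≡ f x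
∑-select {y ∷ X} {x} (y∉ ∷ u) (here refl) f rewrite ≡ᵇ-refl x = begin
  + 1 * f x +ᶻ ∑ X (λ y → ι (x ≡ᵇ y) * f y)
    ≡⟨ cong (λ z → + 1 * f x +ᶻ z) (∑-cong-∈ X λ y y∈ →
         cong (λ t → ι t * f y) (≡ᵇ-false (All.lookup y∉ y∈))) ⟩
  + 1 * f x +ᶻ ∑ X (λ y → + 0 * f y)
    ≡⟨ cong₂ _+ᶻ_ (ℤ.*-identityˡ (f x)) (≡.trans (∑-cong X (λ y → ℤ.*-zeroˡ (f y))) (∑-zero X)) ⟩
  f x +ᶻ + 0
    ≡⟨ ℤ.+-identityʳ _ ⟩
  f x ∎
  where open ≡-Reasoning
∑-select {y ∷ X} {x} (y∉ ∷ u) (there x∈) f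
  rewrite ≡ᵇ-false {x} {y} (λ { refl → All.lookup y∉ x∈ refl }) =
  ≡.trans (cong (λ k → k +ᶻ ∑ X (λ z → ι (x ≡ᵇ z) * f z)) (ℤ.*-zeroˡ (f y)))
    (≡.trans (ℤ.+-identityˡ (∑ X (λ z → ι (x ≡ᵇ z) * f z))) (∑-select u x∈ f))

-- The one property of the monomial test that collapsing a block needs: adjacent powers of the same
-- variable may be merged. Abstracting it lets the induction in `collapse` absorb a finished power
-- into the test.
Additive : (List (ℕ × ℕ) → Bool) → Set
Additive M = ∀ ps x c d qs → M (ps ++ (x , c) ∷ (x , d) ∷ qs) ≡ M (ps ++ (x , c + d) ∷ qs)

Additive-∷ : ∀ {M} p → Additive M → Additive (M ∘ (p ∷_))
Additive-∷ p add ps = add (p ∷ ps)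

-- The sequences counted by adjRef are constant on the blocks of α, hence are
-- determined by one value for each part.
collapse : ∀ {X} → Unique X → ∀ M → Additive M → ∀ a ss c {x} → x ∈ X → length ss ≡ ones a →
  ∑ (seqs (length a) X) (λ xs → ι (adjRef a ss x xs) * ι (M ((x , c) ∷ map (_, 1) xs)))
  ≡ ∑ (seqs (ones a) X) (λ fs → ι (adjB ss x fs) * ι (M (zip (x ∷ fs) (grp c a))))
collapse u M add [] [] c x∈ e = refl
collapse {X} u M add (false ∷ a) ss c {x} x∈ e = begin
  ∑ (seqs (suc (length a)) X) _
    ≡⟨ ∑-seqs (length a) X _ ⟩
  ∑ X (λ y → ∑ Xs (λ xs → ι ((x ≡ᵇ y) ∧ adjRef a ss y xs) * ι (M ((x , c) ∷ (y , 1) ∷ map (_, 1) xs))))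
    ≡⟨ ∑-cong X (λ y → ∑-cong Xs (λ xs →
         ≡.trans (cong (_* ι (M ((x , c) ∷ (y , 1) ∷ map (_, 1) xs))) (ι-∧ (x ≡ᵇ y) (adjRef a ss y xs)))
                 (ℤ.*-assoc (ι (x ≡ᵇ y)) (ι (adjRef a ss y xs)) _))) ⟩
  ∑ X (λ y → ∑ Xs (λ xs → ι (x ≡ᵇ y) * F y xs))
    ≡⟨ ∑-cong X (λ y → ∑-*ˡ (ι (x ≡ᵇ y)) Xs (F y)) ⟩
  ∑ X (λ y → ι (x ≡ᵇ y) * ∑ Xs (F y))
    ≡⟨ ∑-select u x∈ (λ y → ∑ Xs (F y)) ⟩
  ∑ Xs (F x)
    -- The index is forced to equal `x`, so its exponent 1 is added to the `c` units already
    -- gathered in the current block.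
    ≡⟨ ∑-cong Xs (λ xs → cong (λ t → ι (adjRef a ss x xs) * ι t)
         (≡.trans (add [] x c 1 (map (_, 1) xs)) (cong (λ k → M ((x , k) ∷ map (_, 1) xs)) (ℕ.+-comm c 1)))) ⟩
  ∑ Xs (λ xs → ι (adjRef a ss x xs) * ι (M ((x , suc c) ∷ map (_, 1) xs)))
    ≡⟨ collapse u M add a ss (suc c) x∈ e ⟩
  ∑ (seqs (ones a) X) (λ fs → ι (adjB ss x fs) * ι (M (zip (x ∷ fs) (grp (suc c) a)))) ∎
  where
  open ≡-Reasoning
  Xs = seqs (length a) X
  F : ℕ → List ℕ → ℤ
  F y xs = ι (adjRef a ss y xs) * ι (M ((x , c) ∷ (y , 1) ∷ map (_, 1) xs))
collapse {X} u M add (true ∷ a) (s ∷ ss) c {x} x∈ e = begin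
  ∑ (seqs (suc (length a)) X) _
    ≡⟨ ∑-seqs (length a) X _ ⟩
  ∑ X (λ y → ∑ (seqs (length a) X) (λ xs → ι (lt y ∧ adjRef a ss y xs) * ι (M ((x , c) ∷ (y , 1) ∷ map (_, 1) xs))))
    ≡⟨ ∑-cong X (λ y → factor (lt y) (seqs (length a) X) (adjRef a ss y) _) ⟩
  ∑ X (λ y → ι (lt y) * ∑ (seqs (length a) X) (λ xs → ι (adjRef a ss y xs) * ι (M ((x , c) ∷ (y , 1) ∷ map (_, 1) xs))))
    -- The block of `x` is complete: its power moves into the test, and the next block starts at `y`
    -- with one unit.
    ≡⟨ ∑-cong-∈ X (λ y y∈ → cong (ι (lt y) *_)
         (collapse u (λ ps → M ((x , c) ∷ ps)) (Additive-∷ {M} (x , c) add) a ss 1 y∈ (ℕ.suc-injective e))) ⟩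
  ∑ X (λ y → ι (lt y) * ∑ (seqs (ones a) X) (λ fs → ι (adjB ss y fs) * ι (M ((x , c) ∷ zip (y ∷ fs) (grp 1 a)))))
    ≡⟨ ∑-cong X (λ y → sym (factor (lt y) (seqs (ones a) X) (adjB ss y) _)) ⟩
  ∑ X (λ y → ∑ (seqs (ones a) X) (λ fs → ι (lt y ∧ adjB ss y fs) * ι (M ((x , c) ∷ zip (y ∷ fs) (grp 1 a)))))
    ≡⟨ sym (∑-seqs (ones a) X _) ⟩
  ∑ (seqs (suc (ones a)) X) _ ∎
  where
  open ≡-Reasoning
  lt : ℕ → Bool
  lt y = if s then x <ᵇ y else x ≤ᵇ y
  factor : ∀ t (L : List (List ℕ)) (g : List ℕ → Bool) (h : List ℕ → ℤ) →
           ∑ L (λ xs → ι (t ∧ g xs) * h xs) ≡ ι t * ∑ L (λ xs → ι (g xs) * h xs)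
  factor t L g h = ≡.trans
    (∑-cong L (λ xs → ≡.trans (cong (_* h xs) (ι-∧ t (g xs))) (ℤ.*-assoc (ι t) (ι (g xs)) (h xs))))
    (∑-*ˡ (ι t) L _)

all-cong : ∀ {p q : A → Bool} → p ≗ q → ∀ xs → all p xs ≡ all q xs
all-cong eq []       = refl
all-cong eq (x ∷ xs) = cong₂ _∧_ (eq x) (all-cong eq xs)

isMonomial-additive : ∀ e → Additive (isMonomial e)
isMonomial-additive e ps x c d qs =
  all-cong (λ ie → cong (_≡ᵇ proj₂ ie) (exponent (proj₁ ie) ps)) (zip (one-to (length e)) e)
  where
  exponent : ∀ i ps → sum (map proj₂ (filterᵇ (λ p → proj₁ p ≡ᵇ i) (ps ++ (x , c) ∷ (x , d) ∷ qs)))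
                    ≡ sum (map proj₂ (filterᵇ (λ p → proj₁ p ≡ᵇ i) (ps ++ (x , c + d) ∷ qs)))
  exponent i [] with x ≡ᵇ i in eq
  ... | true rewrite eq = sym (ℕ.+-assoc c d _)
  ... | false rewrite eq = refl
  exponent i ((y , k) ∷ ps) with y ≡ᵇ i
  ... | true  = cong (λ z → k + z) (exponent i ps)
  ... | false = exponent i ps

-- Enumerating the compositions of a positive integer by bit sequences

filterᵇ-⁺ : ∀ (p : A → Bool) {x xs} → x ∈ xs → p x ≡ true → x ∈ filterᵇ p xs
filterᵇ-⁺ p x∈ eq = ∈-filter⁺ (T? ∘ p) x∈ (≡⇒T eq)

filterᵇ-⁻ : ∀ (p : A → Bool) {x} xs → x ∈ filterᵇ p xs → x ∈ xs × p x ≡ true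
filterᵇ-⁻ p xs x∈ with ∈-filter⁻ (T? ∘ p) {xs = xs} x∈
... | x∈′ , t = x∈′ , T⇒≡ t

one-to-unique : ∀ m → Unique (one-to m)
one-to-unique m = Unique.applyUpTo⁺₁ suc m (λ i<j _ eq → ℕ.<⇒≢ i<j (ℕ.suc-injective eq))

-- The part being written has size `c + k`: `c` units are done and `k` remain, each of them costing
-- one false bit. The next part begins with a true bit, which accounts for its first unit.
toBits : ∀ c k α → All (1 ≤_) α → ∃[ b ] length b ≡ k + sum α × grp c b ≡ (c + k) ∷ α
toBits c (suc k) α pos with toBits (suc c) k α pos
... | b , len , eq = false ∷ b , cong suc len , ≡.trans eq (cong (_∷ α) (sym (ℕ.+-suc c k)))
toBits c zero [] pos = [] , refl , cong [_] (sym (ℕ.+-identityʳ c))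
toBits c zero (suc k ∷ α) (_ ∷ pos) with toBits 1 k α pos
... | b , len , eq = true ∷ b , cong suc len , cong₂ _∷_ (sym (ℕ.+-identityʳ c)) eq

composition⇒grp : ∀ {m α} → IsComposition (suc m) α → ∃[ b ] length b ≡ m × grp 1 b ≡ α
composition⇒grp {α = suc k ∷ α} (_ ∷ pos , eq) with toBits 1 k α pos
... | b , len , e = b , ≡.trans len (ℕ.suc-injective eq) , e

length≤sum : ∀ {α} → All (1 ≤_) α → length α ≤ sum α
length≤sum []          = z≤n
length≤sum (1≤a ∷ pos) = ℕ.+-mono-≤ 1≤a (length≤sum pos)

∈⇒≤sum : ∀ {x α} → x ∈ α → x ≤ sum α
∈⇒≤sum (here refl)          = ℕ.m≤m+n _ _
∈⇒≤sum {α = a ∷ α} (there x∈) = ℕ.≤-trans (∈⇒≤sum x∈) (ℕ.m≤n+m (sum α) a)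

∈-one-to⁺ : ∀ {x m} → 1 ≤ x → x ≤ m → x ∈ one-to m
∈-one-to⁺ {suc x} 1≤x x<m = ∈-applyUpTo⁺ suc x<m

∈-one-to⁻ : ∀ {x m} → x ∈ one-to m → 1 ≤ x × x ≤ m
∈-one-to⁻ x∈ with ∈-applyUpTo⁻ suc x∈
... | i , i<m , refl = s≤s z≤n , i<m

∈-compositions⁺ : ∀ {n α} → IsComposition n α → α ∈ compositions n
∈-compositions⁺ {n} {α} (pos , refl) = filterᵇ-⁺ (λ β → sum β ≡ᵇ n)
  (∈-concatMap⁺ (λ l → seqs l (one-to n)) (∈-upTo⁺ (s≤s (length≤sum pos)))
    (∈-seqs⁺ (All.tabulate (λ a∈ → ∈-one-to⁺ (All.lookup pos a∈) (∈⇒≤sum a∈)))))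
  (≡ᵇ-refl (sum α))

∈-compositions⁻ : ∀ {n α} → α ∈ compositions n → IsComposition n α
∈-compositions⁻ {n} {α} α∈ with filterᵇ-⁻ (λ β → sum β ≡ᵇ n) _ α∈
... | α∈′ , eq with ∈-concatMap⁻ (λ l → seqs l (one-to n)) (upTo (suc n)) α∈′
... | l , _ , α∈″ = All.map (proj₁ ∘ ∈-one-to⁻) (proj₂ (∈-seqs⁻ l α∈″)) , ≡ᵇ-true⇒≡ eq

compositions-unique : ∀ n → Unique (compositions n)
compositions-unique n = Unique.filter⁺ (T? ∘ (λ β → sum β ≡ᵇ n))
  (concatMap-unique _ (Unique.upTo⁺ (suc n)) (λ l → seqs-unique l (one-to-unique n))
    (λ {l} {l′} p q → ≡.trans (sym (proj₁ (∈-seqs⁻ l p))) (proj₁ (∈-seqs⁻ l′ q))))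

eqB-sound : ∀ d b → eqB d b ≡ true → d ≡ b
eqB-sound []          []          _  = refl
eqB-sound (true  ∷ d) (true  ∷ b) eq = cong (true ∷_) (eqB-sound d b eq)
eqB-sound (false ∷ d) (false ∷ b) eq = cong (false ∷_) (eqB-sound d b eq)

==-refl : ∀ xs → (xs == xs) ≡ true
==-refl []       = refl
==-refl (x ∷ xs) rewrite ≡ᵇ-refl x = ==-refl xs

∧-true⁻ : ∀ {a b} → a ∧ b ≡ true → a ≡ true × b ≡ true
∧-true⁻ {true} {true} _ = refl , refl

∧-true⁺ : ∀ {a b} → a ≡ true → b ≡ true → a ∧ b ≡ true
∧-true⁺ refl refl = refl

==-sound : ∀ xs ys → (xs == ys) ≡ true → xs ≡ ys
==-sound []       []       _  = refl
==-sound (x ∷ xs) (y ∷ ys) eq with ∧-true⁻ {x ≡ᵇ y} eq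
... | p , q = cong₂ _∷_ (≡ᵇ-true⇒≡ p) (==-sound xs ys q)

grp-injective : ∀ c d b → length d ≡ length b → grp c d ≡ grp c b → d ≡ b
grp-injective c d b len eq = eqB-sound d b (≡.trans (sym (grp-== c d b len))
  (≡.trans (cong (_== grp c b) eq) (==-refl (grp c b))))

bits-unique : Unique bits
bits-unique = ((λ ()) ∷ []) ∷ [] ∷ []

∈-bits : ∀ b → b ∈ bits
∈-bits true  = here refl
∈-bits false = there (here refl)

-- This turns the sum over β into a sum over m independent bits, the form in which it factors over
-- positions.
compositions-↭ : ∀ m → compositions (suc m) ↭ map (grp 1) (seqs m bits)
compositions-↭ m = unique∧set⇒↭ (compositions-unique (suc m))
  (map-unique (grp 1) (λ {d} {b} d∈ b∈ → grp-injective 1 d b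
    (≡.trans (proj₁ (∈-seqs⁻ m d∈)) (sym (proj₁ (∈-seqs⁻ m b∈))))) (seqs-unique m bits-unique))
  to from
  where
  to : ∀ {α} → α ∈ compositions (suc m) → α ∈ map (grp 1) (seqs m bits)
  to {α} α∈ with composition⇒grp {m} (∈-compositions⁻ {suc m} {α} α∈)
  ... | b , len , refl = ∈-map⁺ (grp 1)
    (subst (λ k → b ∈ seqs k bits) len (∈-seqs⁺ (All.tabulate (λ {t} _ → ∈-bits t))))
  from : ∀ {α} → α ∈ map (grp 1) (seqs m bits) → α ∈ compositions (suc m)
  from α∈ with ∈-map⁻ (grp 1) α∈
  ... | b , b∈ , refl = ∈-compositions⁺ (grp-positive 1 b (s≤s z≤n) ,
    ≡.trans (sum-grp 1 b) (cong suc (proj₁ (∈-seqs⁻ m b∈))))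

-- Matrices and increasing runs

all-⁻ : ∀ (p : A → Bool) {xs x} → all p xs ≡ true → x ∈ xs → p x ≡ true
all-⁻ p {y ∷ xs} eq (here refl) = proj₁ (∧-true⁻ {p y} eq)
all-⁻ p {y ∷ xs} eq (there x∈)  = all-⁻ p (proj₂ (∧-true⁻ {p y} eq)) x∈

all-⁺ : ∀ (p : A → Bool) xs → (∀ {x} → x ∈ xs → p x ≡ true) → all p xs ≡ true
all-⁺ p []       h = refl
all-⁺ p (x ∷ xs) h = ∧-true⁺ (h (here refl)) (all-⁺ p xs (λ x∈ → h (there x∈)))

all-zip-⁻ : ∀ (P : ℕ → ℕ → Bool) f ws →
  all (λ ja → P (proj₁ ja) (proj₂ ja)) (zip (applyUpTo f (length ws)) ws) ≡ true →
  ∀ {j} → j < length ws → P (f j) (nth j ws) ≡ true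
all-zip-⁻ P f (v ∷ ws) eq {zero}  _         = proj₁ (∧-true⁻ {P (f 0) v} eq)
all-zip-⁻ P f (v ∷ ws) eq {suc j} (s≤s j<) = all-zip-⁻ P (f ∘ suc) ws (proj₂ (∧-true⁻ {P (f 0) v} eq)) j<

all-zip-⁺ : ∀ (P : ℕ → ℕ → Bool) f ws → (∀ j → j < length ws → P (f j) (nth j ws) ≡ true) →
  all (λ ja → P (proj₁ ja) (proj₂ ja)) (zip (applyUpTo f (length ws)) ws) ≡ true
all-zip-⁺ P f []       h = refl
all-zip-⁺ P f (v ∷ ws) h =
  ∧-true⁺ (h 0 (s≤s z≤n)) (all-zip-⁺ P (f ∘ suc) ws (λ j j< → h (suc j) (s≤s j<)))

count : ℕ → List ℕ → ℕ
count x xs = length (filterᵇ (x ≡ᵇ_) xs)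

count-++ : ∀ x xs ys → count x (xs ++ ys) ≡ count x xs + count x ys
count-++ x []       ys = refl
count-++ x (y ∷ xs) ys with x ≡ᵇ y
... | true  = cong suc (count-++ x xs ys)
... | false = count-++ x xs ys

count-< : ∀ {x xs} → All (x <_) xs → count x xs ≡ 0
count-< []                         = refl
count-< {x} {y ∷ xs} (x<y ∷ x<xs) rewrite ≡ᵇ-false (ℕ.<⇒≢ x<y) = count-< x<xs

count-∈ : ∀ {x xs} → x ∈ xs → 1 ≤ count x xs
count-∈ {x} (here refl) rewrite ≡ᵇ-refl x = s≤s z≤n
count-∈ {x} {y ∷ xs} (there x∈) with x ≡ᵇ y
... | true  = s≤s z≤n
... | false = count-∈ x∈

count-unique : ∀ xs → (∀ {x} → x ∈ xs → count x xs ≤ 1) → Unique xs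
count-unique []       h = []
count-unique (x ∷ xs) h = All.tabulate x∉ ∷ count-unique xs (λ {y} y∈ → ℕ.≤-trans (mono y) (h (there y∈)))
  where
  mono : ∀ y → count y xs ≤ count y (x ∷ xs)
  mono y with y ≡ᵇ x
  ... | true  = ℕ.n≤1+n _
  ... | false = ℕ.≤-refl
  x∉ : ∀ {y} → y ∈ xs → x ≢ y
  x∉ y∈ refl with h (here refl)
  ... | bound rewrite ≡ᵇ-refl x = ℕ.<⇒≱ (s≤s (count-∈ y∈)) bound

-- Here and in rowOf, o is the position of the first entry of the row.
nz : ℕ → List ℕ → List ℕ
nz o []      = []
nz o (x ∷ r) = if nonzeroᵇ x then o ∷ nz (suc o) r else nz (suc o) r

rowOf : ℕ → List ℕ → List ℕ → List ℕ
rowOf o []       g = []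
rowOf o (v ∷ ws) g = (if elemᵇ o g then v else 0) ∷ rowOf (suc o) ws g

-- The part of condition (2) visible within a single row. That a column has exactly one nonzero
-- entry concerns all rows at once and is handled by counting.
Fits : List ℕ → List ℕ → Set
Fits = Pointwise (λ v x → x ≡ 0 ⊎ x ≡ v)

nzIdx-nz : ∀ r → nzIdx r ≡ nz 0 r
nzIdx-nz r = go (λ i → i) 0 r (λ _ → refl)
  where
  go : ∀ f o r → (∀ i → f i ≡ o + i) →
       map proj₁ (filterᵇ (λ p → nonzeroᵇ (proj₂ p)) (zip (applyUpTo f (length r)) r)) ≡ nz o r
  go f o []      eq = refl
  go f o (x ∷ r) eq with nonzeroᵇ x
  ... | true  = cong₂ _∷_ (≡.trans (eq 0) (ℕ.+-identityʳ o))
                  (go (f ∘ suc) (suc o) r (λ i → ≡.trans (eq (suc i)) (ℕ.+-suc o i)))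
  ... | false = go (f ∘ suc) (suc o) r (λ i → ≡.trans (eq (suc i)) (ℕ.+-suc o i))

nz-≥ : ∀ o r → All (o ≤_) (nz o r)
nz-≥ o []      = []
nz-≥ o (x ∷ r) with nonzeroᵇ x
... | true  = ℕ.≤-refl ∷ All.map ℕ.<⇒≤ (nz-≥ (suc o) r)
... | false = All.map ℕ.<⇒≤ (nz-≥ (suc o) r)

nz-< : ∀ o r → All (_< o + length r) (nz o r)
nz-< o []      = []
nz-< o (x ∷ r) with nonzeroᵇ x | All.map (λ {j} → subst (j <_) (sym (ℕ.+-suc o (length r)))) (nz-< (suc o) r)
... | true  | rest = ℕ.m<m+n o (s≤s z≤n) ∷ rest
... | false | rest = rest

nz-increasing : ∀ o r → AllPairs _<_ (nz o r)
nz-increasing o []      = []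
nz-increasing o (x ∷ r) with nonzeroᵇ x
... | true  = nz-≥ (suc o) r ∷ nz-increasing (suc o) r
... | false = nz-increasing (suc o) r

nonzeroᵇ-≥ : ∀ {v} → 1 ≤ v → nonzeroᵇ v ≡ true
nonzeroᵇ-≥ (s≤s _) = refl

rowOf-skip : ∀ o ws {h} g → h < o → rowOf o ws (h ∷ g) ≡ rowOf o ws g
rowOf-skip o []       g h<o = refl
rowOf-skip o (v ∷ ws) {h} g h<o rewrite ≡ᵇ-false (ℕ.>⇒≢ h<o) =
  cong (_ ∷_) (rowOf-skip (suc o) ws g (ℕ.m≤n⇒m≤1+n h<o))

rowOf-fits : ∀ o ws g → Fits ws (rowOf o ws g)
rowOf-fits o []       g = []
rowOf-fits o (v ∷ ws) g with elemᵇ o g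
... | true  = inj₂ refl ∷ rowOf-fits (suc o) ws g
... | false = inj₁ refl ∷ rowOf-fits (suc o) ws g

-- A row remembers only which indices occur, so the list is recovered because it is increasing and
-- lies within the row; positive weights keep an occupied cell from looking empty.
nz-rowOf : ∀ o ws {g} → All (1 ≤_) ws → AllPairs _<_ g → All (o ≤_) g → All (_< o + length ws) g →
           nz o (rowOf o ws g) ≡ g
nz-rowOf o [] {[]}    pos inc lo hi = refl
nz-rowOf o [] {h ∷ g} pos inc (o≤h ∷ _) (h<o ∷ _) =
  contradiction o≤h (ℕ.<⇒≱ (subst (h <_) (ℕ.+-identityʳ o) h<o))
nz-rowOf o (v ∷ ws) {[]} (1≤v ∷ pos) inc lo hi = nz-rowOf (suc o) ws pos [] [] []
nz-rowOf o (v ∷ ws) {h ∷ g} (1≤v ∷ pos) (h<g ∷ inc) (o≤h ∷ lo) (h< ∷ hi)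
  with subst (λ k → All (_< k) (h ∷ g)) (ℕ.+-suc o (length ws)) (h< ∷ hi) | ℕ.m≤n⇒m<n∨m≡n o≤h
... | h<′ ∷ hi′ | inj₂ refl rewrite ≡ᵇ-refl o | nonzeroᵇ-≥ 1≤v | rowOf-skip (suc o) ws g (ℕ.n<1+n o) =
  cong (o ∷_) (nz-rowOf (suc o) ws pos inc h<g hi′)
... | hi′ | inj₁ o<h rewrite elemᵇ-< {o} {h ∷ g} (o<h ∷ All.map (ℕ.<-trans o<h) h<g) =
  nz-rowOf (suc o) ws pos (h<g ∷ inc) (o<h ∷ All.map (ℕ.<-trans o<h) h<g) hi′

rowOf-nz : ∀ o {ws r} → All (1 ≤_) ws → Fits ws r → rowOf o ws (nz o r) ≡ r
rowOf-nz o [] [] = refl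
rowOf-nz o {v ∷ ws} {x ∷ r} (1≤v ∷ pos) (inj₁ refl ∷ fits)
  rewrite elemᵇ-< (nz-≥ (suc o) r) = cong (0 ∷_) (rowOf-nz (suc o) pos fits)
rowOf-nz o {v ∷ ws} {x ∷ r} (1≤v ∷ pos) (inj₂ refl ∷ fits)
  rewrite nonzeroᵇ-≥ 1≤v | ≡ᵇ-refl o | rowOf-skip (suc o) ws (nz (suc o) r) (ℕ.n<1+n o) =
  cong (v ∷_) (rowOf-nz (suc o) pos fits)

filter-nonzero : ∀ {ws r} → All (1 ≤_) ws → Fits ws r → filterᵇ nonzeroᵇ r ≡ map (λ j → nth j ws) (nz 0 r)
filter-nonzero {ws} pos fits = go _ 0 pos fits (λ _ → refl)
  where
  go : ∀ f o {ws r} → All (1 ≤_) ws → Fits ws r → (∀ i → nth i ws ≡ f (o + i)) →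
       filterᵇ nonzeroᵇ r ≡ map f (nz o r)
  go f o [] [] eq = refl
  go f o {v ∷ ws} (1≤v ∷ pos) (inj₁ refl ∷ fits) eq =
    go f (suc o) pos fits (λ i → ≡.trans (eq (suc i)) (cong f (ℕ.+-suc o i)))
  go f o {v ∷ ws} (1≤v ∷ pos) (inj₂ refl ∷ fits) eq rewrite nonzeroᵇ-≥ 1≤v =
    cong₂ _∷_ (≡.trans (eq 0) (cong f (ℕ.+-identityʳ o)))
      (go f (suc o) pos fits (λ i → ≡.trans (eq (suc i)) (cong f (ℕ.+-suc o i))))

sum-filter-nonzero : ∀ r → sum (filterᵇ nonzeroᵇ r) ≡ sum r
sum-filter-nonzero []          = refl
sum-filter-nonzero (zero  ∷ r) = sum-filter-nonzero r
sum-filter-nonzero (suc x ∷ r) = cong (λ z → suc x + z) (sum-filter-nonzero r)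

count-nz : ∀ o j r → count (o + j) (nz o r) ≡ (if nonzeroᵇ (nth j r) then 1 else 0)
count-nz o zero    [] = refl
count-nz o (suc j) [] = refl
count-nz o zero (x ∷ r) rewrite ℕ.+-identityʳ o with nonzeroᵇ x
... | true rewrite ≡ᵇ-refl o = cong suc (count-< (nz-≥ (suc o) r))
... | false = count-< (nz-≥ (suc o) r)
count-nz o (suc j) (x ∷ r) rewrite ℕ.+-suc o j with nonzeroᵇ x
... | true rewrite ≡ᵇ-false {suc o + j} {o} (ℕ.>⇒≢ (s≤s (ℕ.m≤m+n o j))) = count-nz (suc o) j r
... | false = count-nz (suc o) j r

-- Exchanges reading by rows with reading by columns: each occurrence of `j` in the word is a row
-- whose entry in column `j` is nonzero. Condition (2) thereby corresponds to the word being a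
-- permutation of the columns.
count-column : ∀ j M → count j (concat (map (nz 0) M)) ≡ length (filterᵇ nonzeroᵇ (map (nth j) M))
count-column j []      = refl
count-column j (r ∷ M) rewrite count-++ j (nz 0 r) (concat (map (nz 0) M)) | count-nz 0 j r | count-column j M
  with nonzeroᵇ (nth j r)
... | true  = refl
... | false = refl

fits-nth⁺ : ∀ {ws r} → length r ≡ length ws →
  (∀ j → j < length ws → nth j r ≡ 0 ⊎ nth j r ≡ nth j ws) → Fits ws r
fits-nth⁺ {[]}     {[]}    len h = []
fits-nth⁺ {v ∷ ws} {x ∷ r} len h =
  h 0 (s≤s z≤n) ∷ fits-nth⁺ (ℕ.suc-injective len) (λ j j< → h (suc j) (s≤s j<))

fits-nth⁻ : ∀ {ws r} → Fits ws r → ∀ j → nth j r ≡ 0 ⊎ nth j r ≡ nth j ws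
fits-nth⁻ []         zero    = inj₁ refl
fits-nth⁻ []         (suc j) = inj₁ refl
fits-nth⁻ (p ∷ fits) zero    = p
fits-nth⁻ (p ∷ fits) (suc j) = fits-nth⁻ fits j

fits-length : ∀ {ws r} → Fits ws r → length r ≡ length ws
fits-length []         = refl
fits-length (_ ∷ fits) = cong suc (fits-length fits)

column-entry : ∀ {v} {xs} → filterᵇ nonzeroᵇ xs ≡ [ v ] → ∀ {x} → x ∈ xs → x ≡ 0 ⊎ x ≡ v
column-entry eq {zero}  x∈ = inj₁ refl
column-entry {v} eq {suc x} x∈ with subst (suc x ∈_) eq (filterᵇ-⁺ nonzeroᵇ x∈ refl)
... | here e = inj₂ e

column-singleton : ∀ {v} xs → (∀ {x} → x ∈ xs → x ≡ 0 ⊎ x ≡ v) →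
  length (filterᵇ nonzeroᵇ xs) ≡ 1 → filterᵇ nonzeroᵇ xs ≡ [ v ]
column-singleton xs h len with filterᵇ nonzeroᵇ xs | (λ {x} → filterᵇ-⁻ nonzeroᵇ {x} xs)
column-singleton xs h len | y ∷ [] | mem with mem (here refl)
... | y∈ , y≢0 with h y∈
... | inj₂ refl = refl
column-singleton xs h len | .0 ∷ [] | mem | y∈ , () | inj₁ refl

-- Condition (4) on index lists. The default `false` excludes a zero row as soon as there are at
-- least two rows.
after : List ℕ → List ℕ → Bool
after g g′ with lastM g | firstM g′
... | just a | just b = b <ᵇ a
... | _      | _      = false

consecutive : List (List ℕ) → Bool
consecutive (g ∷ g′ ∷ G) = after g g′ ∧ consecutive (g′ ∷ G)
consecutive _            = true

rightOf-after : ∀ r r′ → rightOf r r′ ≡ after (nz 0 r) (nz 0 r′)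
rightOf-after r r′ rewrite sym (nzIdx-nz r) | sym (nzIdx-nz r′) with lastM (nzIdx r) | firstM (nzIdx r′)
... | just _  | just _  = refl
... | just _  | nothing = refl
... | nothing | just _  = refl
... | nothing | nothing = refl

consecRows-consecutive : ∀ M → consecRows M ≡ consecutive (map (nz 0) M)
consecRows-consecutive []           = refl
consecRows-consecutive (r ∷ [])     = refl
consecRows-consecutive (r ∷ r′ ∷ M) = cong₂ _∧_ (rightOf-after r r′) (consecRows-consecutive (r′ ∷ M))

-- The first maximal increasing run of i ∷ σ (without i) and the remaining runs.
runsFrom : ℕ → List ℕ → List ℕ × List (List ℕ)
runsFrom i []      = [] , []
runsFrom i (j ∷ σ) = let (g , G) = runsFrom j σ in
  if i <ᵇ j then (j ∷ g , G) else ([] , (j ∷ g) ∷ G)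

runs : List ℕ → List (List ℕ)
runs []      = []
runs (i ∷ σ) = let (g , G) = runsFrom i σ in (i ∷ g) ∷ G

concat-runs : ∀ σ → concat (runs σ) ≡ σ
concat-runs []      = refl
concat-runs (i ∷ σ) = cong (i ∷_) (go i σ)
  where
  go : ∀ i σ → proj₁ (runsFrom i σ) ++ concat (proj₂ (runsFrom i σ)) ≡ σ
  go i []      = refl
  go i (j ∷ σ) with i <ᵇ j
  ... | true  = cong (j ∷_) (go j σ)
  ... | false = cong (j ∷_) (go j σ)

runs-increasing : ∀ σ → All (AllPairs _<_) (runs σ)
runs-increasing []      = []
runs-increasing (i ∷ σ) = let (p , q) = go i σ in p ∷ q
  where
  go : ∀ i σ → AllPairs _<_ (i ∷ proj₁ (runsFrom i σ)) × All (AllPairs _<_) (proj₂ (runsFrom i σ))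
  go i []      = ([] ∷ []) , []
  go i (j ∷ σ) with i <ᵇ j in eq | go j σ
  ... | true  | (j<g ∷ inc) , rest =
        ((<ᵇ-true⇒< {i} {j} eq ∷ All.map (ℕ.<-trans (<ᵇ-true⇒< {i} {j} eq)) j<g) ∷ j<g ∷ inc) , rest
  ... | false | inc , rest = ([] ∷ []) , inc ∷ rest

≮ᵇ⇒>ᵇ : ∀ {i j} → (i <ᵇ j) ≡ false → i ≢ j → (j <ᵇ i) ≡ true
≮ᵇ⇒>ᵇ {i} {j} eq i≢j with ℕ.<-cmp i j
... | tri< i<j _ _ with () ← ≡.trans (sym eq) (<ᵇ-true i<j)
... | tri≈ _ i≡j _ = contradiction i≡j i≢j
... | tri> _ _ j<i = <ᵇ-true j<i

consecutive-∷ : ∀ i j g G → consecutive ((i ∷ j ∷ g) ∷ G) ≡ consecutive ((j ∷ g) ∷ G)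
consecutive-∷ i j g []      = refl
consecutive-∷ i j g (_ ∷ G) = refl

-- A run ends where the sequence fails to increase. As the entries are distinct, this is a strict
-- descent, which condition (4) demands between the end of one row and the start of the next.
runs-consecutive : ∀ {σ} → Unique σ → consecutive (runs σ) ≡ true
runs-consecutive []      = refl
runs-consecutive {i ∷ σ} (i∉ ∷ u) = go i σ i∉ u
  where
  go : ∀ i σ → All (i ≢_) σ → Unique σ →
       consecutive ((i ∷ proj₁ (runsFrom i σ)) ∷ proj₂ (runsFrom i σ)) ≡ true
  go i []      _          _         = refl
  go i (j ∷ σ) (i≢j ∷ _) (j∉ ∷ u) with i <ᵇ j in eq
  ... | true  = ≡.trans (consecutive-∷ i j (proj₁ (runsFrom j σ)) (proj₂ (runsFrom j σ))) (go j σ j∉ u)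
  ... | false = ∧-true⁺ (≮ᵇ⇒>ᵇ {i} {j} eq i≢j) (go j σ j∉ u)

-- Every step inside a block ascends and every junction of blocks descends, so the decomposition
-- into maximal runs cuts exactly at the junctions.
runs-concat : ∀ {i g G} → All (AllPairs _<_) ((i ∷ g) ∷ G) → consecutive ((i ∷ g) ∷ G) ≡ true →
              runs (concat ((i ∷ g) ∷ G)) ≡ (i ∷ g) ∷ G
runs-concat {i} {g} {G} inc con = cong (λ { (g , G) → (i ∷ g) ∷ G }) (go i g G inc con)
  where
  go : ∀ i g G → All (AllPairs _<_) ((i ∷ g) ∷ G) → consecutive ((i ∷ g) ∷ G) ≡ true →
       runsFrom i (g ++ concat G) ≡ (g , G)
  go i [] [] inc con = refl
  go i [] ((j ∷ g) ∷ G) (_ ∷ inc) con with ∧-true⁻ {j <ᵇ i} con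
  ... | j<i , con′ rewrite go j g G inc con′ | <ᵇ-false (ℕ.<⇒≤ (<ᵇ-true⇒< {j} {i} j<i)) = refl
  go i (j ∷ g) G (((i<j ∷ _) ∷ incg) ∷ inc) con
    rewrite go j g G (incg ∷ inc) (≡.trans (sym (consecutive-∷ i j g G)) con) | <ᵇ-true i<j = refl

-- Sequences of columns and their bijection with matrices

insertDesc-↭ : ∀ x ys → insertDesc x ys ↭ x ∷ ys
insertDesc-↭ x []       = ↭-refl
insertDesc-↭ x (y ∷ ys) with y ≤ᵇ x
... | true  = ↭-refl
... | false = ↭-trans (↭-prep y (insertDesc-↭ x ys)) (↭-swap y x ↭-refl)

sortDesc-↭ : ∀ xs → sortDesc xs ↭ xs
sortDesc-↭ []       = ↭-refl
sortDesc-↭ (x ∷ xs) = ↭-trans (insertDesc-↭ x (sortDesc xs)) (↭-prep x (sortDesc-↭ xs))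

isPerm : ℕ → List ℕ → Bool
isPerm N σ = all (λ j → count j σ ≡ᵇ 1) (upTo N)

weights : List ℕ → List ℕ → List ℕ
weights ws σ = map (λ j → nth j ws) σ

blocks : List ℕ → List ℕ → List ℕ
blocks ws σ = map (sum ∘ weights ws) (runs σ)

nth-∈ : ∀ ws {j} → j < length ws → nth j ws ∈ ws
nth-∈ (v ∷ ws) {zero}  _        = here refl
nth-∈ (v ∷ ws) {suc j} (s≤s j<) = there (nth-∈ ws j<)

∈-nth : ∀ {r x} → x ∈ r → ∃[ j ] j < length r × x ≡ nth j r
∈-nth (here refl) = 0 , s≤s z≤n , refl
∈-nth (there x∈) with ∈-nth x∈
... | j , j< , eq = suc j , s≤s j< , eq

All-concat⁺ : ∀ {P : A → Set} {G} → All (All P) G → All P (concat G)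
All-concat⁺ []                        = []
All-concat⁺ {G = [] ∷ G} (_ ∷ ps)     = All-concat⁺ ps
All-concat⁺ {G = (x ∷ g) ∷ G} ((p ∷ ps) ∷ pss) = p ∷ All-concat⁺ (ps ∷ pss)

All-concat⁻ : ∀ {P : A → Set} G → All P (concat G) → All (All P) G
All-concat⁻ []            ps       = []
All-concat⁻ ([] ∷ G)      ps       = [] ∷ All-concat⁻ G ps
All-concat⁻ ((x ∷ g) ∷ G) (p ∷ ps) with All-concat⁻ (g ∷ G) ps
... | qs ∷ qss = (p ∷ qs) ∷ qss

map-id-∈ : ∀ (f : A → A) {xs} → All (λ x → f x ≡ x) xs → map f xs ≡ xs
map-id-∈ f []         = refl
map-id-∈ f (eq ∷ eqs) = cong₂ _∷_ eq (map-id-∈ f eqs)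

map-cong-All : ∀ {B : Set} {f g : A → B} {xs} → All (λ x → f x ≡ g x) xs → map f xs ≡ map g xs
map-cong-All []         = refl
map-cong-All (eq ∷ eqs) = cong₂ _∷_ eq (map-cong-All eqs)

-- A matrix corresponds to the sequence of column indices of its nonzero
-- entries, in reading order; conditions (1) and (4) say that its rows are the
-- maximal increasing runs of that sequence.
module MatrixBijection (α δ : List ℕ) (pos : All (1 ≤_) α) (α≢[] : α ≢ []) where

  ws = sortDesc α
  N  = length α
  wt : ℕ → ℕ
  wt j = nth j ws

  len-ws : length ws ≡ N
  len-ws = ↭-length (sortDesc-↭ α)

  pos-ws : All (1 ≤_) ws
  pos-ws = All-resp-↭ (↭-sym (sortDesc-↭ α)) pos

  chains : List (List ℕ)
  chains = filterᵇ (λ σ → isPerm N σ ∧ (weights ws σ == α) ∧ (blocks ws σ == δ)) (seqs N (upTo N))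

  rows : List (List ℕ)
  rows = seqs N (upTo (suc (sum α)))

  matrices : List (List (List ℕ))
  matrices = filterᵇ (isQMatrix α δ) (seqs (length δ) rows)

  toMatrix : List ℕ → List (List ℕ)
  toMatrix σ = map (rowOf 0 ws) (runs σ)

  fromMatrix : List (List ℕ) → List ℕ
  fromMatrix M = concat (map (nz 0) M)

  record Chain (σ : List ℕ) : Set where
    field
      size   : length σ ≡ N
      bound  : All (_< N) σ
      perm   : ∀ {j} → j < N → count j σ ≡ 1
      weight : weights ws σ ≡ α
      block  : blocks ws σ ≡ δ

  record Matrix (M : List (List ℕ)) : Set where
    field
      size   : length M ≡ length δ
      fits   : All (Fits ws) M
      rowSum : map sum M ≡ δ
      column : ∀ {j} → j < N → filterᵇ nonzeroᵇ (map (nth j) M) ≡ [ wt j ]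
      word   : concat (map (filterᵇ nonzeroᵇ) M) ≡ α
      consec : consecutive (map (nz 0) M) ≡ true

  chain⁻ : ∀ {σ} → σ ∈ chains → Chain σ
  chain⁻ {σ} σ∈ with filterᵇ-⁻ (λ σ → isPerm N σ ∧ (weights ws σ == α) ∧ (blocks ws σ == δ)) (seqs N (upTo N)) σ∈
  ... | σ∈′ , eq with ∧-true⁻ {isPerm N σ} eq
  ... | p , q with ∧-true⁻ {weights ws σ == α} q
  ... | r , s = record
    { size   = proj₁ (∈-seqs⁻ N σ∈′)
    ; bound  = All.map ∈-upTo⁻ (proj₂ (∈-seqs⁻ N σ∈′))
    ; perm   = λ j< → ≡ᵇ-true⇒≡ (all-⁻ (λ j → count j σ ≡ᵇ 1) p (∈-upTo⁺ j<))
    ; weight = ==-sound _ _ r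
    ; block  = ==-sound _ _ s
    }

  chain⁺ : ∀ {σ} → Chain σ → σ ∈ chains
  chain⁺ {σ} c = filterᵇ-⁺ (λ σ → isPerm N σ ∧ (weights ws σ == α) ∧ (blocks ws σ == δ))
    (subst (λ k → σ ∈ seqs k (upTo N)) size (∈-seqs⁺ (All.map ∈-upTo⁺ bound)))
    (∧-true⁺ (all-⁺ _ (upTo N) (λ j∈ → ≡.trans (cong (_≡ᵇ 1) (perm (∈-upTo⁻ j∈))) refl))
      (∧-true⁺ (≡.trans (cong (_== α) weight) (==-refl α)) (≡.trans (cong (_== δ) block) (==-refl δ))))
    where open Chain c

  columnᵇ : List (List ℕ) → ℕ → ℕ → Bool
  columnᵇ M j a = filterᵇ nonzeroᵇ (map (nth j) M) == [ a ]

  -- Each entry is zero or a part of α, so enumerating entries up to |α| misses no matrix.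
  entry-bound : ∀ {r} → Fits ws r → All (_≤ sum α) r
  entry-bound {r} fits = All.tabulate bound
    where
    bound : ∀ {x} → x ∈ r → x ≤ sum α
    bound x∈ with ∈-nth x∈
    ... | j , j< , refl with fits-nth⁻ fits j
    ... | inj₁ eq rewrite eq = z≤n
    ... | inj₂ eq rewrite eq =
      subst (nth j ws ≤_) (sum-↭ (sortDesc-↭ α)) (∈⇒≤sum (nth-∈ ws (subst (j <_) (fits-length fits) j<)))

  matrix⁺ : ∀ {M} → Matrix M → M ∈ matrices
  matrix⁺ {M} m = filterᵇ-⁺ (isQMatrix α δ)
    (subst (λ k → M ∈ seqs k rows) size (∈-seqs⁺ (All.map row∈ fits)))
    (∧-true⁺ (≡.trans (cong (_== δ) rowSum) (==-refl δ))
      (∧-true⁺ (subst (λ n → all (λ ja → columnᵇ M (proj₁ ja) (proj₂ ja)) (zip (upTo n) ws) ≡ true) len-ws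
                 (all-zip-⁺ (columnᵇ M) (λ i → i) ws (λ j j< →
                   ≡.trans (cong (_== [ wt j ]) (column (subst (j <_) len-ws j<))) (==-refl [ wt j ]))))
        (∧-true⁺ (≡.trans (cong (_== α) word) (==-refl α)) (≡.trans (consecRows-consecutive M) consec))))
    where
    open Matrix m
    row∈ : ∀ {r} → Fits ws r → r ∈ rows
    row∈ {r} f = subst (λ k → r ∈ seqs k (upTo (suc (sum α)))) (≡.trans (fits-length f) len-ws)
      (∈-seqs⁺ (All.map (∈-upTo⁺ ∘ s≤s) (entry-bound f)))

  matrix⁻ : ∀ {M} → M ∈ matrices → Matrix M
  matrix⁻ {M} M∈ with filterᵇ-⁻ (isQMatrix α δ) (seqs (length δ) rows) M∈
  ... | M∈′ , eq with ∧-true⁻ {map sum M == δ} eq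
  ... | p , eq₁ with ∧-true⁻ {all (λ ja → columnᵇ M (proj₁ ja) (proj₂ ja)) (zip (upTo N) ws)} eq₁
  ... | q , eq₂ with ∧-true⁻ {concat (map (filterᵇ nonzeroᵇ) M) == α} eq₂
  ... | r , s = record
    { size   = proj₁ (∈-seqs⁻ (length δ) M∈′)
    ; fits   = All.tabulate (λ r∈ → row-fits r∈ (proj₁ (∈-seqs⁻ N (All.lookup (proj₂ (∈-seqs⁻ (length δ) M∈′)) r∈))))
    ; rowSum = ==-sound _ _ p
    ; column = column
    ; word   = ==-sound _ _ r
    ; consec = ≡.trans (sym (consecRows-consecutive M)) s
    }
    where
    column : ∀ {j} → j < N → filterᵇ nonzeroᵇ (map (nth j) M) ≡ [ wt j ]
    column {j} j< = ==-sound _ _ (all-zip-⁻ (columnᵇ M) (λ i → i) ws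
      (subst (λ n → all (λ ja → columnᵇ M (proj₁ ja) (proj₂ ja)) (zip (upTo n) ws) ≡ true) (sym len-ws) q)
      (subst (j <_) (sym len-ws) j<))
    row-fits : ∀ {r} → r ∈ M → length r ≡ N → Fits ws r
    row-fits {r} r∈ len = fits-nth⁺ (≡.trans len (sym len-ws)) (λ j j< →
      column-entry (column (subst (j <_) len-ws j<)) (∈-map⁺ (nth j) r∈))

  nz-toMatrix : ∀ {σ} → Chain σ → map (nz 0) (toMatrix σ) ≡ runs σ
  nz-toMatrix {σ} c = ≡.trans (sym (map-∘ (runs σ))) (map-id-∈ (nz 0 ∘ rowOf 0 ws)
    (All.zipWith (λ { (inc , bnd) → nz-rowOf 0 ws pos-ws inc (All.tabulate (λ _ → z≤n))
                       (All.map (λ {j} → subst (j <_) (sym len-ws)) bnd) })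
      (runs-increasing σ , All-concat⁻ (runs σ) (subst (All (_< N)) (sym (concat-runs σ)) (Chain.bound c)))))

  map-rowOf-fits : ∀ G → All (Fits ws) (map (rowOf 0 ws) G)
  map-rowOf-fits []      = []
  map-rowOf-fits (g ∷ G) = rowOf-fits 0 ws g ∷ map-rowOf-fits G

  words : ∀ {M} → All (Fits ws) M → map (filterᵇ nonzeroᵇ) M ≡ map (weights ws) (map (nz 0) M)
  words {M} fits = ≡.trans (map-cong-All (All.map (filter-nonzero pos-ws) fits)) (map-∘ M)

  rowSums : ∀ {M} → All (Fits ws) M → map sum M ≡ map (sum ∘ weights ws) (map (nz 0) M)
  rowSums {M} fits = begin
    map sum M                                 ≡⟨ map-cong (λ r → sym (sum-filter-nonzero r)) M ⟩
    map (sum ∘ filterᵇ nonzeroᵇ) M            ≡⟨ map-∘ M ⟩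
    map sum (map (filterᵇ nonzeroᵇ) M)        ≡⟨ cong (map sum) (words fits) ⟩
    map sum (map (weights ws) (map (nz 0) M)) ≡⟨ sym (map-∘ (map (nz 0) M)) ⟩
    map (sum ∘ weights ws) (map (nz 0) M)     ∎
    where open ≡-Reasoning

  from-to : ∀ {σ} → Chain σ → fromMatrix (toMatrix σ) ≡ σ
  from-to {σ} c = ≡.trans (cong concat (nz-toMatrix c)) (concat-runs σ)

  toMatrix-∈ : ∀ {σ} → Chain σ → Matrix (toMatrix σ)
  toMatrix-∈ {σ} c = record
    { size   = ≡.trans (length-map _ (runs σ)) (≡.trans (sym (length-map _ (runs σ))) (cong length block))
    ; fits   = fits
    ; rowSum = ≡.trans (rowSums fits) (≡.trans (cong (map (sum ∘ weights ws)) (nz-toMatrix c)) block)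
    -- The permutation property supplies exactly one nonzero entry in the column; `column-fits`
    -- determines its value.
    ; column = λ {j} j< → column-singleton _ (column-fits j)
                 (≡.trans (sym (count-column j (toMatrix σ))) (≡.trans (cong (count j) (from-to c)) (perm j<)))
    ; word   = begin
        concat (map (filterᵇ nonzeroᵇ) (toMatrix σ))        ≡⟨ cong concat (words fits) ⟩
        concat (map (weights ws) (map (nz 0) (toMatrix σ))) ≡⟨ cong (concat ∘ map (weights ws)) (nz-toMatrix c) ⟩
        concat (map (weights ws) (runs σ))                  ≡⟨ concat-map (runs σ) ⟩
        weights ws (concat (runs σ))                        ≡⟨ cong (weights ws) (concat-runs σ) ⟩
        weights ws σ                                        ≡⟨ weight ⟩
        α                                                   ∎
    ; consec = ≡.trans (cong consecutive (nz-toMatrix c)) (runs-consecutive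
                 (count-unique σ (λ j∈ → ℕ.≤-reflexive (perm (All.lookup bound j∈)))))
    }
    where
    open Chain c
    open ≡-Reasoning
    fits = map-rowOf-fits (runs σ)
    column-fits : ∀ j {x} → x ∈ map (nth j) (toMatrix σ) → x ≡ 0 ⊎ x ≡ wt j
    column-fits j x∈ with ∈-map⁻ (nth j) x∈
    ... | r , r∈ , refl = fits-nth⁻ (All.lookup fits r∈) j

  runs-fromMatrix : ∀ {M} → Matrix M → runs (fromMatrix M) ≡ map (nz 0) M
  runs-fromMatrix {M} m = go (map (nz 0) M) (increasing M) consec nonempty
    where
    open Matrix m
    increasing : ∀ M → All (AllPairs _<_) (map (nz 0) M)
    increasing []      = []
    increasing (r ∷ M) = nz-increasing 0 r ∷ increasing M
    nonempty : concat (map (nz 0) M) ≢ []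
    nonempty eq = α≢[] (begin
      α                                      ≡⟨ sym word ⟩
      concat (map (filterᵇ nonzeroᵇ) M)      ≡⟨ cong concat (words fits) ⟩
      concat (map (weights ws) (map (nz 0) M)) ≡⟨ concat-map (map (nz 0) M) ⟩
      weights ws (concat (map (nz 0) M))     ≡⟨ cong (weights ws) eq ⟩
      []                                     ∎)
      where open ≡-Reasoning
    go : ∀ G → All (AllPairs _<_) G → consecutive G ≡ true → concat G ≢ [] → runs (concat G) ≡ G
    go []            inc con ne = refl
    -- A lone zero row passes condition (4) vacuously; it would make the word empty, contrary to
    -- `α≢[]`.
    go ([] ∷ [])     inc con ne = contradiction refl ne
    go ([] ∷ _ ∷ _)  inc () ne
    go ((i ∷ g) ∷ G) inc con ne = runs-concat inc con

  weights-fromMatrix : ∀ {M} → Matrix M → weights ws (fromMatrix M) ≡ α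
  weights-fromMatrix {M} m = begin
    weights ws (concat (map (nz 0) M))       ≡⟨ sym (concat-map (map (nz 0) M)) ⟩
    concat (map (weights ws) (map (nz 0) M)) ≡⟨ cong concat (sym (words fits)) ⟩
    concat (map (filterᵇ nonzeroᵇ) M)        ≡⟨ word ⟩
    α                                        ∎
    where
    open Matrix m
    open ≡-Reasoning

  fromMatrix-∈ : ∀ {M} → Matrix M → Chain (fromMatrix M)
  fromMatrix-∈ {M} m = record
    { size   = ≡.trans (sym (length-map wt (fromMatrix M))) (cong length (weights-fromMatrix m))
    ; bound  = All-concat⁺ (bounds fits)
    ; perm   = λ {j} j< → ≡.trans (count-column j M) (cong length (column j<))
    ; weight = weights-fromMatrix m
    ; block  = ≡.trans (cong (map (sum ∘ weights ws)) (runs-fromMatrix m)) (≡.trans (sym (rowSums fits)) rowSum)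
    }
    where
    open Matrix m
    bounds : ∀ {M} → All (Fits ws) M → All (All (_< N)) (map (nz 0) M)
    bounds []                = []
    bounds {r ∷ M} (f ∷ fits) =
      All.map (λ {j} → subst (j <_) (≡.trans (fits-length f) len-ws)) (nz-< 0 r) ∷ bounds fits

  to-from : ∀ {M} → Matrix M → toMatrix (fromMatrix M) ≡ M
  to-from {M} m = begin
    map (rowOf 0 ws) (runs (fromMatrix M)) ≡⟨ cong (map (rowOf 0 ws)) (runs-fromMatrix m) ⟩
    map (rowOf 0 ws) (map (nz 0) M)        ≡⟨ sym (map-∘ M) ⟩
    map (rowOf 0 ws ∘ nz 0) M              ≡⟨ map-id-∈ _ (All.map (rowOf-nz 0 pos-ws) (Matrix.fits m)) ⟩
    M                                      ∎
    where open ≡-Reasoning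

  chains-matrices : length chains ≡ length matrices
  chains-matrices = bijection⇒length
    (Unique.filter⁺ (T? ∘ _) (seqs-unique N (Unique.upTo⁺ N)))
    (Unique.filter⁺ (T? ∘ _) (seqs-unique (length δ) (seqs-unique N (Unique.upTo⁺ (suc (sum α))))))
    toMatrix fromMatrix
    (λ σ∈ → matrix⁺ (toMatrix-∈ (chain⁻ σ∈))) (λ M∈ → chain⁺ (fromMatrix-∈ (matrix⁻ M∈)))
    (λ σ∈ → from-to (chain⁻ σ∈)) (λ M∈ → to-from (matrix⁻ M∈))

Q-chains : ∀ α δ → All (1 ≤_) α → α ≢ [] →
  length (filterᵇ (λ σ → isPerm (length α) σ ∧ (weights (sortDesc α) σ == α) ∧ (blocks (sortDesc α) σ == δ))
                  (seqs (length α) (upTo (length α))))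
  ≡ Q α δ
Q-chains α δ pos α≢[] = MatrixBijection.chains-matrices α δ pos α≢[]

-- Linear extensions as permutations of columns

Descending : List ℕ → Set
Descending = AllPairs (λ x y → y ≤ x)

insertDesc-descending : ∀ x {ys} → Descending ys → Descending (insertDesc x ys)
insertDesc-descending x []              = [] ∷ []
insertDesc-descending x {y ∷ ys} (y≥ ∷ d) with y ≤ᵇ x in eq
... | true  = (y≤x ∷ All.map (λ z≤y → ℕ.≤-trans z≤y y≤x) y≥) ∷ y≥ ∷ d
  where y≤x = ℕ.≤ᵇ⇒≤ y x (≡⇒T eq)
... | false = All-resp-↭ (↭-sym (insertDesc-↭ x ys)) (ℕ.<⇒≤ (ℕ.≰⇒> y≰x) ∷ y≥) ∷ insertDesc-descending x d
  where
  y≰x : ¬ (y ≤ x)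
  y≰x y≤x with () ← ≡.trans (sym eq) (≤ᵇ-true y≤x)

sortDesc-descending : ∀ xs → Descending (sortDesc xs)
sortDesc-descending []       = []
sortDesc-descending (x ∷ xs) = insertDesc-descending x (sortDesc-descending xs)

count-∉ : ∀ {x xs} → x ∉ xs → count x xs ≡ 0
count-∉ {xs = []}     x∉ = refl
count-∉ {x} {y ∷ xs}  x∉ rewrite ≡ᵇ-false {x} {y} (λ eq → x∉ (here eq)) = count-∉ (λ x∈ → x∉ (there x∈))

count-pos⇒∈ : ∀ {x} xs → 1 ≤ count x xs → x ∈ xs
count-pos⇒∈ {x} (y ∷ xs) 1≤ with x ≡ᵇ y in eq
... | true  = here (≡ᵇ-true⇒≡ eq)
... | false = there (count-pos⇒∈ xs 1≤)

count-↭ : ∀ x {xs ys} → xs ↭ ys → count x xs ≡ count x ys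
count-↭ x p = ↭-length (filter-↭ (T? ∘ (x ≡ᵇ_)) p)

descending-head-≤ : ∀ {x y xs ys} → Descending (y ∷ ys) → count x (x ∷ xs) ≡ count x (y ∷ ys) → x ≤ y
descending-head-≤ {x} {y} {xs} {ys} (y≥ ∷ _) eq
  with count-pos⇒∈ {x} (y ∷ ys) (subst (1 ≤_) eq (count-∈ {x} {x ∷ xs} (here refl)))
... | here refl = ℕ.≤-refl
... | there x∈  = All.lookup y≥ x∈

descending-unique : ∀ {xs ys} → Descending xs → Descending ys → (∀ x → count x xs ≡ count x ys) → xs ≡ ys
descending-unique {[]}     {[]}     dx dy eq = refl
descending-unique {[]}     {y ∷ ys} dx dy eq with eq y
... | e rewrite ≡ᵇ-refl y with () ← e
descending-unique {x ∷ xs} {[]}     dx dy eq with eq x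
... | e rewrite ≡ᵇ-refl x with () ← e
descending-unique {x ∷ xs} {y ∷ ys} dx dy eq
  with ℕ.≤-antisym (descending-head-≤ {xs = xs} dy (eq x)) (descending-head-≤ {xs = ys} dx (sym (eq y)))
descending-unique {x ∷ xs} {.x ∷ ys} (_ ∷ dx) (_ ∷ dy) eq | refl = cong (x ∷_) (descending-unique dx dy eq′)
  where
  eq′ : ∀ z → count z xs ≡ count z ys
  eq′ z with z ≡ᵇ x | eq z
  ... | true  | e = ℕ.suc-injective e
  ... | false | e = e

count-const : ∀ x a (ks : List ℕ) → count x (map w (map (a ,_) ks)) ≡ (if x ≡ᵇ a then length ks else 0)
count-const x a [] with x ≡ᵇ a
... | true  = refl
... | false = refl
count-const x a (k ∷ ks) with x ≡ᵇ a | count-const x a ks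
... | true  | ih = cong suc ih
... | false | ih = ih

module _ (mu : ℕ → ℕ) where
  blockElts : ℕ → List Elt
  blockElts a = map (a ,_) (one-to (mu a))

  count-blocks-∉ : ∀ {x} L → x ∉ L → count x (map w (concatMap blockElts L)) ≡ 0
  count-blocks-∉ []      x∉ = refl
  count-blocks-∉ {x} (a ∷ L) x∉
    rewrite map-++ w (blockElts a) (concatMap blockElts L)
          | count-++ x (map w (blockElts a)) (map w (concatMap blockElts L))
          | count-const x a (one-to (mu a)) | ≡ᵇ-false {x} {a} (λ eq → x∉ (here eq)) =
    count-blocks-∉ L (λ x∈ → x∉ (there x∈))

  count-blocks-∈ : ∀ {x L} → Unique L → x ∈ L → count x (map w (concatMap blockElts L)) ≡ mu x
  count-blocks-∈ {x} {a ∷ L} (a∉ ∷ u) x∈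
    rewrite map-++ w (blockElts a) (concatMap blockElts L)
          | count-++ x (map w (blockElts a)) (map w (concatMap blockElts L))
          | count-const x a (one-to (mu a)) with x∈
  ... | here refl rewrite ≡ᵇ-refl x | length-applyUpTo suc (mu x)
                        | count-blocks-∉ {x} L (λ x∈ → All.lookup a∉ x∈ refl) = ℕ.+-identityʳ (mu x)
  ... | there x∈′ rewrite ≡ᵇ-false {x} {a} (λ { refl → All.lookup a∉ x∈′ refl }) = count-blocks-∈ u x∈′

ltNN-⁻ : ∀ {u v} → ltNN u v ≡ true → proj₁ u < proj₁ v ⊎ (proj₁ u ≡ proj₁ v × proj₂ u < proj₂ v)
ltNN-⁻ {a , k} {b , l} eq with a <ᵇ b in e
... | true  = inj₁ (<ᵇ-true⇒< e)
... | false with ∧-true⁻ {a ≡ᵇ b} eq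
... | p , q = inj₂ (≡ᵇ-true⇒≡ p , <ᵇ-true⇒< q)

ltNN-irrefl : ∀ u → ltNN u u ≡ false
ltNN-irrefl (a , k) rewrite <ᵇ-false (ℕ.≤-refl {a}) | ≡ᵇ-refl a = <ᵇ-false (ℕ.≤-refl {k})

ltNN-asym : ∀ {u v} → ltNN u v ≡ true → ltNN v u ≡ false
ltNN-asym {a , k} {b , l} eq with ltNN-⁻ {a , k} {b , l} eq
... | inj₁ a<b rewrite <ᵇ-false (ℕ.<⇒≤ a<b) | ≡ᵇ-false {b} {a} (ℕ.>⇒≢ a<b) = refl
... | inj₂ (refl , k<l) rewrite <ᵇ-false (ℕ.≤-refl {a}) | ≡ᵇ-refl a = <ᵇ-false (ℕ.<⇒≤ k<l)

ltNN⇒≢ : ∀ {u v} → ltNN u v ≡ true → eqElt u v ≡ false × eqElt v u ≡ false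
ltNN⇒≢ {a , k} {b , l} eq with ltNN-⁻ {a , k} {b , l} eq
... | inj₁ a<b rewrite ≡ᵇ-false {a} {b} (ℕ.<⇒≢ a<b) | ≡ᵇ-false {b} {a} (ℕ.>⇒≢ a<b) = refl , refl
... | inj₂ (refl , k<l) rewrite ≡ᵇ-refl a | ≡ᵇ-false {k} {l} (ℕ.<⇒≢ k<l) | ≡ᵇ-false {l} {k} (ℕ.>⇒≢ k<l) = refl , refl

AllPairs-reverse : ∀ {R : A → A → Set} {xs} → AllPairs R xs → AllPairs (λ x y → R y x) (reverse xs)
AllPairs-reverse []                      = []
AllPairs-reverse {R = R} {x ∷ xs} (x∼ ∷ p) rewrite unfold-reverse x xs =
  AllPairs.++⁺ (AllPairs-reverse p) ([] ∷ [])
    (All.map (λ r → r ∷ []) (All-resp-↭ (↭-sym (↭-reverse xs)) x∼))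

elems-increasing : ∀ α → AllPairs (λ u v → ltNN u v ≡ true) (elems α)
elems-increasing α = go (AllPairs.applyUpTo⁺₁ suc (sum α) (λ i<j _ → s≤s i<j))
  where
  mu : ℕ → ℕ
  mu a = mult a (sortDesc α)
  within : ∀ a {ks} → AllPairs _<_ ks → AllPairs (λ u v → ltNN u v ≡ true) (map (a ,_) ks)
  within a p = AllPairs.map⁺ (AllPairs.map
    (λ k<l → cong₂ _∨_ (<ᵇ-false (ℕ.≤-refl {a})) (∧-true⁺ (≡ᵇ-refl a) (<ᵇ-true k<l))) p)
  go : ∀ {L} → AllPairs _<_ L → AllPairs (λ u v → ltNN u v ≡ true) (concatMap (blockElts mu) L)
  go []            = []
  go {a ∷ L} (a< ∷ p) = AllPairs.++⁺ (within a (AllPairs.applyUpTo⁺₁ suc (mu a) (λ i<j _ → s≤s i<j))) (go p)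
    (All.tabulate λ {u} u∈ → All.tabulate λ {v} v∈ → below u∈ v∈)
    where
    below : ∀ {u v} → u ∈ blockElts mu a → v ∈ concatMap (blockElts mu) L → ltNN u v ≡ true
    below u∈ v∈ with ∈-map⁻ (a ,_) u∈ | ∈-concatMap⁻ (blockElts mu) L v∈
    ... | k , _ , refl | b , b∈ , v∈′ with ∈-map⁻ (b ,_) v∈′
    ... | l , _ , refl rewrite <ᵇ-true (All.lookup a< b∈) = refl

nthElt : ℕ → List Elt → Elt
nthElt _       []       = 0 , 0
nthElt zero    (u ∷ us) = u
nthElt (suc i) (u ∷ us) = nthElt i us

w-nthElt : ∀ i us → w (nthElt i us) ≡ nth i (map w us)
w-nthElt zero    []       = refl
w-nthElt (suc i) []       = refl
w-nthElt zero    (u ∷ us) = refl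
w-nthElt (suc i) (u ∷ us) = w-nthElt i us

map-nthElt : ∀ us → map (λ i → nthElt i us) (upTo (length us)) ≡ us
map-nthElt us = go us (λ i → i) (λ _ → refl)
  where
  go : ∀ vs f → (∀ i → nthElt (f i) us ≡ nthElt i vs) → map (λ i → nthElt i us) (applyUpTo f (length vs)) ≡ vs
  go []       f eq = refl
  go (v ∷ vs) f eq = cong₂ _∷_ (eq 0) (go vs (f ∘ suc) (eq ∘ suc))

nthElt-∈ : ∀ us {i} → i < length us → nthElt i us ∈ us
nthElt-∈ (u ∷ us) {zero}  _        = here refl
nthElt-∈ (u ∷ us) {suc i} (s≤s i<) = there (nthElt-∈ us i<)

nthElt-related : ∀ {R : Elt → Elt → Set} {us i j} → AllPairs R us → i < j → j < length us →
                 R (nthElt i us) (nthElt j us)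
nthElt-related {us = u ∷ us} {zero}  {suc j} (u∼ ∷ p) i<j (s≤s j<) = All.lookup u∼ (nthElt-∈ us j<)
nthElt-related {us = u ∷ us} {suc i} {suc j} (u∼ ∷ p) (s≤s i<j) (s≤s j<) = nthElt-related p i<j j<

all-↭ : ∀ (p : A → Bool) {xs ys} → xs ↭ ys → all p xs ≡ all p ys
all-↭ p refl         = refl
all-↭ p (prep x q)   = cong (p x ∧_) (all-↭ p q)
all-↭ p (swap {xs} {ys} x y q) = begin
  p x ∧ p y ∧ all p xs   ≡⟨ sym (∧-assoc (p x) (p y) _) ⟩
  (p x ∧ p y) ∧ all p xs ≡⟨ cong₂ _∧_ (∧-comm (p x) (p y)) (all-↭ p q) ⟩
  (p y ∧ p x) ∧ all p ys ≡⟨ ∧-assoc (p y) (p x) _ ⟩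
  p y ∧ p x ∧ all p ys   ∎
  where open ≡-Reasoning
all-↭ p (trans q r)  = ≡.trans (all-↭ p q) (all-↭ p r)

all-map-cong : ∀ {p : B → Bool} {q : A → Bool} (h : A → B) xs → (∀ {x} → x ∈ xs → p (h x) ≡ q x) →
               all p (map h xs) ≡ all q xs
all-map-cong h []       eq = refl
all-map-cong h (x ∷ xs) eq = cong₂ _∧_ (eq (here refl)) (all-map-cong h xs (λ x∈ → eq (there x∈)))

-- The elements of P^α̃ in decreasing order of ℕ_ℕ, so that the i-th one has
-- weight α̃ᵢ and belongs to column i.
columnElts : List ℕ → List Elt
columnElts α = reverse (elems α)

columnElt : List ℕ → ℕ → Elt
columnElt α i = nthElt i (columnElts α)

-- Both lists are weakly decreasing, so equal multiplicities suffice. Values outside 1..|α| need a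
-- separate argument: `elems` never lists them, and positivity of the parts keeps them out of α as
-- well.
map-w-columnElts : ∀ {α} → All (1 ≤_) α → map w (columnElts α) ≡ sortDesc α
map-w-columnElts {α} pos = descending-unique
  (AllPairs.map⁺ (AllPairs.map (λ {u} {v} → weaken {u} {v}) (AllPairs-reverse (elems-increasing α))))
  (sortDesc-descending α) counts
  where
  weaken : ∀ {u v} → ltNN v u ≡ true → w v ≤ w u
  weaken {u} {v} eq with ltNN-⁻ {v} {u} eq
  ... | inj₁ lt         = ℕ.<⇒≤ lt
  ... | inj₂ (refl , _) = ℕ.≤-refl
  counts : ∀ x → count x (map w (columnElts α)) ≡ count x (sortDesc α)
  counts x = ≡.trans (count-↭ x (map⁺ w (↭-reverse (elems α)))) (go (x ℕ.≤? sum α) (1 ℕ.≤? x))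
    where
    mu : ℕ → ℕ
    mu a = mult a (sortDesc α)
    outside : ¬ (1 ≤ x × x ≤ sum α) → count x (map w (elems α)) ≡ count x (sortDesc α)
    outside out = ≡.trans (count-blocks-∉ mu (one-to (sum α)) (λ x∈ → out (∈-one-to⁻ x∈)))
      (sym (count-∉ (λ x∈ → let x∈α = ∈-resp-↭ (sortDesc-↭ α) x∈ in
        out (All.lookup pos x∈α , ∈⇒≤sum x∈α))))
    go : Dec (x ≤ sum α) → Dec (1 ≤ x) → count x (map w (elems α)) ≡ count x (sortDesc α)
    go (yes x≤) (yes 1≤x) = count-blocks-∈ mu (one-to-unique (sum α)) (∈-one-to⁺ 1≤x x≤)
    go (no x≰)  _         = outside (λ b → x≰ (proj₂ b))
    go _        (no 1≰x)  = outside (λ b → 1≰x (proj₁ b))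

length-columnElts : ∀ {α} → All (1 ≤_) α → length (columnElts α) ≡ length α
length-columnElts {α} pos = ≡.trans (sym (length-map w (columnElts α)))
  (≡.trans (cong length (map-w-columnElts pos)) (↭-length (sortDesc-↭ α)))

length-elems : ∀ {α} → All (1 ≤_) α → length (elems α) ≡ length α
length-elems {α} pos = ≡.trans (sym (↭-length (↭-reverse (elems α)))) (length-columnElts pos)

module _ {α : List ℕ} (pos : All (1 ≤_) α) where
  private
    h = columnElt α
    N = length α

  map-columnElt : map h (upTo N) ≡ columnElts α
  map-columnElt = ≡.trans (cong (map h ∘ upTo) (sym (length-columnElts pos))) (map-nthElt (columnElts α))

  w-columnElt : ∀ i → w (h i) ≡ nth i (sortDesc α)
  w-columnElt i = ≡.trans (w-nthElt i (columnElts α)) (cong (nth i) (map-w-columnElts pos))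

  γlt-< : ∀ {i j} → i < j → j < N → γlt (h i) (h j) ≡ true
  γlt-< i<j j< = nthElt-related (AllPairs-reverse (elems-increasing α)) i<j
    (subst (_ <_) (sym (length-columnElts pos)) j<)

  -- Two reversals cancel: the labels live in the reverse of ℕ_ℕ, and the columns list the elements
  -- from the largest down.
  γlt-columnElt : ∀ {i j} → i < N → j < N → γlt (h i) (h j) ≡ (i <ᵇ j)
  γlt-columnElt {i} {j} i< j< with ℕ.<-cmp i j
  ... | tri< i<j _ _  = ≡.trans (γlt-< i<j j<) (sym (<ᵇ-true i<j))
  ... | tri≈ _ refl _ = ≡.trans (ltNN-irrefl (h i)) (sym (<ᵇ-false (ℕ.≤-refl {i})))
  ... | tri> _ _ j<i  = ≡.trans (ltNN-asym {h i} {h j} (γlt-< j<i i<)) (sym (<ᵇ-false (ℕ.<⇒≤ j<i)))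

  eqElt-columnElt : ∀ {i j} → i < N → j < N → eqElt (h i) (h j) ≡ (i ≡ᵇ j)
  eqElt-columnElt {i} {j} i< j< with ℕ.<-cmp i j
  ... | tri< i<j i≢j _  = ≡.trans (proj₂ (ltNN⇒≢ {h j} {h i} (γlt-< i<j j<))) (sym (≡ᵇ-false i≢j))
  ... | tri≈ _ refl _ = ≡.trans (∧-true⁺ (≡ᵇ-refl (proj₁ (h i))) (≡ᵇ-refl (proj₂ (h i)))) (sym (≡ᵇ-refl i))
  ... | tri> _ i≢j j<i  = ≡.trans (proj₁ (ltNN⇒≢ {h i} {h j} (γlt-< j<i i<))) (sym (≡ᵇ-false i≢j))

  countElt-columnElt : ∀ {j σ} → j < N → All (_< N) σ → countElt (h j) (map h σ) ≡ count j σ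
  countElt-columnElt j< [] = refl
  countElt-columnElt {j} {i ∷ σ} j< (i< ∷ σ<) rewrite eqElt-columnElt j< i< with j ≡ᵇ i
  ... | true  = cong suc (countElt-columnElt j< σ<)
  ... | false = countElt-columnElt j< σ<

  isPerm-columnElt : ∀ {σ} → All (_< N) σ → all (λ x → countElt x (map h σ) ≡ᵇ 1) (elems α) ≡ isPerm N σ
  isPerm-columnElt {σ} σ< = begin
    all p (elems α)         ≡⟨ all-↭ p (↭-sym (↭-reverse (elems α))) ⟩
    all p (columnElts α)    ≡⟨ cong (all p) (sym map-columnElt) ⟩
    all p (map h (upTo N))  ≡⟨ all-map-cong h (upTo N) (λ j∈ → cong (_≡ᵇ 1) (countElt-columnElt (∈-upTo⁻ j∈) σ<)) ⟩
    isPerm N σ              ∎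
    where
    open ≡-Reasoning
    p : Elt → Bool
    p x = countElt x (map h σ) ≡ᵇ 1

  αsw-columnElt : ∀ σ → αsw (map h σ) ≡ weights (sortDesc α) σ
  αsw-columnElt σ = ≡.trans (sym (map-∘ σ)) (map-cong w-columnElt σ)

-- A bit is true where a (P,γ)-partition has to increase strictly.
strict : ℕ → List ℕ → List Bool
strict i []      = []
strict i (j ∷ σ) = not (i <ᵇ j) ∷ strict j σ

length-strict : ∀ i σ → length (strict i σ) ≡ length σ
length-strict i []      = refl
length-strict i (j ∷ σ) = cong suc (length-strict j σ)

-- The strict lexicographic order on pairs (column index, value), with the value compared first. Its
-- transitivity reduces the condition on all pairs of the chain to neighbours.
partOK : ℕ × ℕ → ℕ × ℕ → Bool
partOK (i , x) (j , y) = (x ≤ᵇ y) ∧ (not (x ≡ᵇ y) ∨ (i <ᵇ j))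

partOK-⁻ : ∀ {i x j y} → partOK (i , x) (j , y) ≡ true → x < y ⊎ (x ≡ y × i < j)
partOK-⁻ {i} {x} {j} {y} eq with ∧-true⁻ {x ≤ᵇ y} eq
... | p , q with ℕ.m≤n⇒m<n∨m≡n (ℕ.≤ᵇ⇒≤ x y (≡⇒T p))
... | inj₁ x<y  = inj₁ x<y
... | inj₂ refl rewrite ≡ᵇ-refl x = inj₂ (refl , <ᵇ-true⇒< q)

partOK-⁺ : ∀ {i x j y} → x < y ⊎ (x ≡ y × i < j) → partOK (i , x) (j , y) ≡ true
partOK-⁺ (inj₁ x<y) rewrite ≤ᵇ-true (ℕ.<⇒≤ x<y) | ≡ᵇ-false (ℕ.<⇒≢ x<y) = refl
partOK-⁺ {x = x} (inj₂ (refl , i<j)) rewrite ≤ᵇ-true (ℕ.≤-refl {x}) | ≡ᵇ-refl x = <ᵇ-true i<j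

partOK-trans : ∀ {p q r} → partOK p q ≡ true → partOK q r ≡ true → partOK p r ≡ true
partOK-trans {i , x} {j , y} {k , z} pq qr with partOK-⁻ {i} {x} {j} {y} pq | partOK-⁻ {j} {y} {k} {z} qr
... | inj₁ x<y          | inj₁ y<z          = partOK-⁺ {i} {x} {k} {z} (inj₁ (ℕ.<-trans x<y y<z))
... | inj₁ x<y          | inj₂ (refl , _)   = partOK-⁺ {i} {x} {k} {z} (inj₁ x<y)
... | inj₂ (refl , _)   | inj₁ y<z          = partOK-⁺ {i} {x} {k} {z} (inj₁ y<z)
... | inj₂ (refl , i<j) | inj₂ (refl , j<k) = partOK-⁺ {i} {x} {k} {z} (inj₂ (refl , ℕ.<-trans i<j j<k))

linked : (A → A → Bool) → List A → Bool
linked R (p ∷ q ∷ ps) = R p q ∧ linked R (q ∷ ps)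
linked R _            = true

allPairs-linked : ∀ (R : A → A → Bool) → (∀ {p q r} → R p q ≡ true → R q r ≡ true → R p r ≡ true) →
                  ∀ ps → allPairs R ps ≡ linked R ps
allPairs-linked R tr []       = refl
allPairs-linked R tr (p ∷ []) = refl
allPairs-linked R tr (p ∷ q ∷ ps) rewrite sym (allPairs-linked R tr (q ∷ ps))
  with R p q in pq | all (R q) ps in qps
... | false | _     = refl
... | true  | false = ∧-zeroʳ (all (R p) ps)
... | true  | true  rewrite all-⁺ (R p) ps (λ r∈ → tr pq (all-⁻ (R q) qps r∈)) = refl

partOK-strict : ∀ i x j y → partOK (i , x) (j , y) ≡ (if not (i <ᵇ j) then x <ᵇ y else x ≤ᵇ y)
partOK-strict i x j y with ℕ.<-cmp x y
... | tri< x<y x≢y _ rewrite ≤ᵇ-true (ℕ.<⇒≤ x<y) | <ᵇ-true x<y | ≡ᵇ-false x≢y with i <ᵇ j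
...   | true  = refl
...   | false = refl
partOK-strict i x j y | tri≈ _ refl _ rewrite ≤ᵇ-true (ℕ.≤-refl {x}) | <ᵇ-false (ℕ.≤-refl {x}) | ≡ᵇ-refl x with i <ᵇ j
...   | true  = refl
...   | false = refl
partOK-strict i x j y | tri> _ x≢y y<x rewrite ≤ᵇ-false y<x | <ᵇ-false (ℕ.<⇒≤ y<x) with i <ᵇ j
...   | true  = refl
...   | false = refl

linked-strict : ∀ i σ x fs → linked partOK (zip (i ∷ σ) (x ∷ fs)) ≡ adjB (strict i σ) x fs
linked-strict i []      x []       = refl
linked-strict i []      x (y ∷ fs) = refl
linked-strict i (j ∷ σ) x []       = refl
linked-strict i (j ∷ σ) x (y ∷ fs) = cong₂ _∧_ (partOK-strict i x j y) (linked-strict j σ y fs)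

allPairs-zip : ∀ {P : ℕ → Set} (h : ℕ → Elt) {R : Elt × ℕ → Elt × ℕ → Bool} {R′ : ℕ × ℕ → ℕ × ℕ → Bool} →
  (∀ {i j} x y → P i → P j → R (h i , x) (h j , y) ≡ R′ (i , x) (j , y)) →
  ∀ {σ} → All P σ → ∀ f → allPairs R (zip (map h σ) f) ≡ allPairs R′ (zip σ f)
allPairs-zip h eq []           f       = refl
allPairs-zip h eq (pi ∷ pσ)    []      = refl
allPairs-zip {P} h {R} {R′} eq {i ∷ σ} (pi ∷ pσ) (x ∷ f) = cong₂ _∧_ (go pσ f) (allPairs-zip h eq pσ f)
  where
  go : ∀ {σ} → All P σ → ∀ f → all (R (h i , x)) (zip (map h σ) f) ≡ all (R′ (i , x)) (zip σ f)
  go []        f       = refl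
  go (pj ∷ pσ) []      = refl
  go (pj ∷ pσ) (y ∷ f) = cong₂ _∧_ (eq x y pi pj) (go pσ f)

isChainPartition-strict : ∀ {α} → All (1 ≤_) α → ∀ {i σ} → All (_< length α) (i ∷ σ) → ∀ x fs →
  isChainPartition (map (columnElt α) (i ∷ σ)) (x ∷ fs) ≡ adjB (strict i σ) x fs
isChainPartition-strict {α} pos {i} {σ} σ< x fs = begin
  isChainPartition (map (columnElt α) (i ∷ σ)) (x ∷ fs)
    ≡⟨ allPairs-zip (columnElt α) {R′ = partOK}
         (λ x y i< j< → cong (λ t → (x ≤ᵇ y) ∧ (not (x ≡ᵇ y) ∨ t)) (γlt-columnElt pos i< j<)) σ< (x ∷ fs) ⟩
  allPairs partOK (zip (i ∷ σ) (x ∷ fs))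
    ≡⟨ allPairs-linked partOK (λ {p} {q} {r} → partOK-trans {p} {q} {r}) (zip (i ∷ σ) (x ∷ fs)) ⟩
  linked partOK (zip (i ∷ σ) (x ∷ fs))
    ≡⟨ linked-strict i σ x fs ⟩
  adjB (strict i σ) x fs ∎
  where open ≡-Reasoning

-- Expansion of 𝓅_α

-- Identifies δ(s) as the coarsening of α that keeps the boundaries at descents. In the run being
-- read, `k` is the weight of its finished parts and `c` the number of units read of the part of
-- `i`. When a part ends, an ascent adds `c` to `k`, while a descent closes the block and resets `k`
-- to 0.
blocks-strict : ∀ ws a k c i σ → grp c a ≡ weights ws (i ∷ σ) →
  let (g , G) = runsFrom i σ in
  (k + sum (weights ws (i ∷ g))) ∷ map (sum ∘ weights ws) G ≡ grp (k + c) (ref a (strict i σ))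
blocks-strict ws [] k c i [] eq =
  cong (λ z → [ k + z ]) (≡.trans (ℕ.+-identityʳ _) (sym (∷-injectiveˡ eq)))
blocks-strict ws (false ∷ a) k c i σ eq =
  ≡.trans (blocks-strict ws a k (suc c) i σ eq) (cong (λ z → grp z (ref a (strict i σ))) (ℕ.+-suc k c))
blocks-strict ws (true ∷ a) k c i [] eq with grp-head 1 a
... | y , ys , e , _ with () ← ≡.trans (sym e) (∷-injectiveʳ eq)
blocks-strict ws (true ∷ a) k c i (j ∷ σ) eq with i <ᵇ j
... | true  = begin
  (k + (nth i ws + (nth j ws + s))) ∷ rest ≡⟨ cong (λ z → (k + (z + (nth j ws + s))) ∷ rest) (sym (∷-injectiveˡ eq)) ⟩
  (k + (c + (nth j ws + s))) ∷ rest        ≡⟨ cong (_∷ rest) (sym (ℕ.+-assoc k c _)) ⟩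
  (k + c + (nth j ws + s)) ∷ rest          ≡⟨ blocks-strict ws a (k + c) 1 j σ (∷-injectiveʳ eq) ⟩
  grp (k + c + 1) (ref a (strict j σ))     ≡⟨ cong (λ z → grp z (ref a (strict j σ))) (ℕ.+-comm (k + c) 1) ⟩
  grp (suc (k + c)) (ref a (strict j σ))   ∎
  where
  open ≡-Reasoning
  s = sum (weights ws (proj₁ (runsFrom j σ)))
  rest = map (sum ∘ weights ws) (proj₂ (runsFrom j σ))
... | false = cong₂ _∷_ (cong (λ z → k + z) (≡.trans (ℕ.+-identityʳ _) (sym (∷-injectiveˡ eq))))
                (blocks-strict ws a 0 1 j σ (∷-injectiveʳ eq))

-- The left side has the shape of the expansion to be proved: a signed sum over β of 𝒬 times a
-- coefficient of `F_β`. The right side fixes a chain and an index sequence first, leaving innermost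
-- the sum over β that `signed-sum` evaluates.
∑-rearrange : ∀ (ss : List A) (bs : List B) (ys : List C)
  (s : B → ℤ) (g : A → ℤ) (E : A → B → ℤ) (H : B → C → ℤ) (M : C → ℤ) →
  ∑ bs (λ b → s b * (∑ ss (λ σ → g σ * E σ b) * ∑ ys (λ y → H b y * M y)))
  ≡ ∑ ss (λ σ → g σ * ∑ ys (λ y → ∑ bs (λ b → s b * (E σ b * H b y)) * M y))
∑-rearrange ss bs ys s g E H M = begin
  ∑ bs (λ b → s b * (∑ ss (λ σ → g σ * E σ b) * K b))
    ≡⟨ ∑-cong bs (λ b → cong (s b *_) (sym (∑-*ʳ (K b) ss (λ σ → g σ * E σ b)))) ⟩
  ∑ bs (λ b → s b * ∑ ss (λ σ → g σ * E σ b * K b))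
    ≡⟨ ∑-cong bs (λ b → sym (∑-*ˡ (s b) ss (λ σ → g σ * E σ b * K b))) ⟩
  ∑ bs (λ b → ∑ ss (λ σ → s b * (g σ * E σ b * K b)))
    ≡⟨ ∑-swap bs ss (λ b σ → s b * (g σ * E σ b * K b)) ⟩
  ∑ ss (λ σ → ∑ bs (λ b → s b * (g σ * E σ b * K b)))
    ≡⟨ ∑-cong ss (λ σ → ∑-cong bs (λ b → shuffle (s b) (g σ) (E σ b) (K b))) ⟩
  ∑ ss (λ σ → ∑ bs (λ b → g σ * (s b * E σ b * K b)))
    ≡⟨ ∑-cong ss (λ σ → ∑-*ˡ (g σ) bs (λ b → s b * E σ b * K b)) ⟩
  ∑ ss (λ σ → g σ * ∑ bs (λ b → s b * E σ b * K b))
    ≡⟨ ∑-cong ss (λ σ → cong (g σ *_) (inner σ)) ⟩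
  ∑ ss (λ σ → g σ * ∑ ys (λ y → ∑ bs (λ b → s b * (E σ b * H b y)) * M y)) ∎
  where
  open ≡-Reasoning
  open +-*-Solver
  K : _ → ℤ
  K b = ∑ ys (λ y → H b y * M y)
  shuffle : ∀ s g E K → s * (g * E * K) ≡ g * (s * E * K)
  shuffle = solve 4 (λ s g E K → s :* (g :* E :* K) := g :* (s :* E :* K)) refl
  inner : ∀ σ → ∑ bs (λ b → s b * E σ b * K b) ≡ ∑ ys (λ y → ∑ bs (λ b → s b * (E σ b * H b y)) * M y)
  inner σ = begin
    ∑ bs (λ b → s b * E σ b * K b)
      ≡⟨ ∑-cong bs (λ b → sym (∑-*ˡ (s b * E σ b) ys (λ y → H b y * M y))) ⟩
    ∑ bs (λ b → ∑ ys (λ y → s b * E σ b * (H b y * M y)))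
      ≡⟨ ∑-swap bs ys (λ b y → s b * E σ b * (H b y * M y)) ⟩
    ∑ ys (λ y → ∑ bs (λ b → s b * E σ b * (H b y * M y)))
      ≡⟨ ∑-cong ys (λ y → ∑-cong bs (λ b → solve 4 (λ s E H M → s :* E :* (H :* M) := s :* (E :* H) :* M)
           refl (s b) (E σ b) (H b y) (M y))) ⟩
    ∑ ys (λ y → ∑ bs (λ b → s b * (E σ b * H b y) * M y))
      ≡⟨ ∑-cong ys (λ y → ∑-*ʳ (M y) bs (λ b → s b * (E σ b * H b y))) ⟩
    ∑ ys (λ y → ∑ bs (λ b → s b * (E σ b * H b y)) * M y) ∎

ι-*-cong : ∀ t {u v} → (t ≡ true → u ≡ v) → ι t * u ≡ ι t * v
ι-*-cong true  eq = cong (+ 1 *_) (eq refl)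
ι-*-cong false {u} {v} eq = ≡.trans (ℤ.*-zeroˡ u) (sym (ℤ.*-zeroˡ v))

+-coeffK : ∀ {α} → All (1 ≤_) α → ∀ e {i σ m} → All (_< length α) (i ∷ σ) → length σ ≡ m →
  weights (sortDesc α) (i ∷ σ) ≡ α →
  + coeffK (map (columnElt α) (i ∷ σ)) e ≡
  ∑ (one-to (length e)) (λ x → ∑ (seqs m (one-to (length e)))
    (λ fs → ι (adjB (strict i σ) x fs) * ι (isMonomial e (zip (x ∷ fs) α))))
+-coeffK {α} pos e {i} {σ} σ< refl wσ = begin
  + coeffK (map h (i ∷ σ)) e
    ≡⟨ +-length-filter _ (seqs (suc (length (map h σ))) X) ⟩
  ∑ (seqs (suc (length (map h σ))) X) _
    ≡⟨ ∑-seqs (length (map h σ)) X _ ⟩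
  ∑ X (λ x → ∑ (seqs (length (map h σ)) X) (λ fs → F (x ∷ fs)))
    ≡⟨ cong (λ k → ∑ X (λ x → ∑ (seqs k X) (λ fs → F (x ∷ fs)))) (length-map h σ) ⟩
  ∑ X (λ x → ∑ (seqs (length σ) X) (λ fs → F (x ∷ fs)))
    ≡⟨ ∑-cong X (λ x → ∑-cong (seqs (length σ) X) (λ fs →
         ≡.trans (ι-∧ (isChainPartition (map h (i ∷ σ)) (x ∷ fs)) _)
           (cong₂ (λ s t → ι s * ι (isMonomial e (zip (x ∷ fs) t)))
             (isChainPartition-strict pos σ< x fs) (≡.trans (αsw-columnElt pos (i ∷ σ)) wσ)))) ⟩
  ∑ X (λ x → ∑ (seqs (length σ) X) (λ fs → ι (adjB (strict i σ) x fs) * ι (isMonomial e (zip (x ∷ fs) α)))) ∎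
  where
  open ≡-Reasoning
  h = columnElt α
  X = one-to (length e)
  F : List ℕ → ℤ
  F f = ι (isChainPartition (map h (i ∷ σ)) f ∧ isMonomial e (zip f (αsw (map h (i ∷ σ)))))

+-coeffP : ∀ {α} → All (1 ≤_) α → ∀ e →
  + coeffP α e ≡ ∑ (seqs (length α) (upTo (length α))) (λ σ →
    ι (isPerm (length α) σ ∧ (weights (sortDesc α) σ == α)) * + coeffK (map (columnElt α) σ) e)
+-coeffP {α} pos e = begin
  + coeffP α e
    ≡⟨ +-sum-map (λ s → coeffK s e) (filterᵇ (λ s → αsw s == α) (linExts α)) ⟩
  ∑ (filterᵇ (λ s → αsw s == α) (linExts α)) (λ s → + coeffK s e)
    ≡⟨ ∑-filter (λ s → αsw s == α) (linExts α) _ ⟩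
  ∑ (linExts α) (λ s → ι (αsw s == α) * + coeffK s e)
    ≡⟨ ∑-filter (λ s → all (λ x → countElt x s ≡ᵇ 1) (elems α)) (seqs (length (elems α)) (elems α)) _ ⟩
  ∑ (seqs (length (elems α)) (elems α)) F
    ≡⟨ cong (λ k → ∑ (seqs k (elems α)) F) (length-elems pos) ⟩
  ∑ (seqs N (elems α)) F
    -- All sequences over the elements are summed, so the elements may be relisted in column order.
    ≡⟨ ∑-seqs-↭ N (↭-sym (↭-reverse (elems α))) F ⟩
  ∑ (seqs N (columnElts α)) F
    ≡⟨ cong (λ us → ∑ (seqs N us) F) (sym (map-columnElt pos)) ⟩
  ∑ (seqs N (map h (upTo N))) F
    ≡⟨ ∑-seqs-map N h (upTo N) F ⟩
  ∑ (seqs N (upTo N)) (λ σ → F (map h σ))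
    ≡⟨ ∑-cong-∈ (seqs N (upTo N)) (λ σ σ∈ →
         ≡.trans (cong₂ (λ s t → ι s * (ι (t == α) * + coeffK (map h σ) e))
                   (isPerm-columnElt pos (All.map ∈-upTo⁻ (proj₂ (∈-seqs⁻ N σ∈)))) (αsw-columnElt pos σ))
           (≡.trans (sym (ℤ.*-assoc (ι (isPerm N σ)) (ι (weights (sortDesc α) σ == α)) _))
             (cong (_* + coeffK (map h σ) e) (sym (ι-∧ (isPerm N σ) (weights (sortDesc α) σ == α)))))) ⟩
  ∑ (seqs N (upTo N)) (λ σ → ι (isPerm N σ ∧ (weights (sortDesc α) σ == α)) * + coeffK (map h σ) e) ∎
  where
  open ≡-Reasoning
  N = length α
  h = columnElt α
  F : List Elt → ℤ
  F s = ι (all (λ x → countElt x s ≡ᵇ 1) (elems α)) * (ι (αsw s == α) * + coeffK s e)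

headAdj : List Bool → List ℕ → Bool
headAdj b []       = true
headAdj b (x ∷ xs) = adjB b x xs

+-coeffF : ∀ {m} b → length b ≡ m → ∀ e →
  + coeffF (grp 1 b) e ≡ ∑ (seqs (suc m) (one-to (length e)))
    (λ y → ι (headAdj b y) * ι (isMonomial e (map (_, 1) y)))
+-coeffF {m} b refl e = begin
  + coeffF (grp 1 b) e
    ≡⟨ +-length-filter _ (seqs (sum (grp 1 b)) (one-to (length e))) ⟩
  ∑ (seqs (sum (grp 1 b)) (one-to (length e))) F
    ≡⟨ cong (λ k → ∑ (seqs k (one-to (length e))) F) (sum-grp 1 b) ⟩
  ∑ (seqs (suc m) (one-to (length e))) F
    ≡⟨ ∑-cong-∈ (seqs (suc m) (one-to (length e))) (λ y y∈ → pointwise y (proj₁ (∈-seqs⁻ (suc m) {one-to (length e)} y∈))) ⟩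
  ∑ (seqs (suc m) (one-to (length e))) (λ y → ι (headAdj b y) * ι (isMonomial e (map (_, 1) y))) ∎
  where
  open ≡-Reasoning
  F : List ℕ → ℤ
  F y = ι (adjOK 1 (setOf (grp 1 b)) y ∧ isMonomial e (map (_, 1) y))
  pointwise : ∀ y → length y ≡ suc m → F y ≡ ι (headAdj b y) * ι (isMonomial e (map (_, 1) y))
  pointwise (x ∷ xs) len = ≡.trans (ι-∧ (adjOK 1 (setOf (grp 1 b)) (x ∷ xs)) _)
    (cong (λ t → ι t * ι (isMonomial e (map (_, 1) (x ∷ xs))))
      (≡.trans (cong (λ S → adjOK 1 S (x ∷ xs)) (setOf-grp 1 b)) (adjOK-posn 1 b x xs (ℕ.suc-injective len))))

+-Q : ∀ {α} → All (1 ≤_) α → α ≢ [] → ∀ δ →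
  + Q α δ ≡ ∑ (seqs (length α) (upTo (length α))) (λ σ →
    ι (isPerm (length α) σ ∧ (weights (sortDesc α) σ == α)) * ι (blocks (sortDesc α) σ == δ))
+-Q {α} pos α≢[] δ = begin
  + Q α δ
    ≡⟨ cong +_ (sym (Q-chains α δ pos α≢[])) ⟩
  + length (filterᵇ (λ σ → isPerm (length α) σ ∧ (weights (sortDesc α) σ == α) ∧ (blocks (sortDesc α) σ == δ)) S)
    ≡⟨ +-length-filter _ S ⟩
  ∑ S (λ σ → ι (isPerm (length α) σ ∧ (weights (sortDesc α) σ == α) ∧ (blocks (sortDesc α) σ == δ)))
    ≡⟨ ∑-cong S (λ σ → ≡.trans
         (cong ι (sym (∧-assoc (isPerm (length α) σ) (weights (sortDesc α) σ == α) (blocks (sortDesc α) σ == δ))))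
         (ι-∧ (isPerm (length α) σ ∧ (weights (sortDesc α) σ == α)) _)) ⟩
  ∑ S (λ σ → ι (isPerm (length α) σ ∧ (weights (sortDesc α) σ == α)) * ι (blocks (sortDesc α) σ == δ)) ∎
  where
  open ≡-Reasoning
  S = seqs (length α) (upTo (length α))

grp≢[] : ∀ c b → grp c b ≢ []
grp≢[] c b eq with grp-head c b
... | y , ys , e , _ with () ← ≡.trans (sym e) eq

-- `collapse` read backwards spreads the value of each part over a constant block of n indices in
-- all; `signed-sum` read backwards then replaces constancy on blocks by an alternating sum over β.
expand-coeffK : ∀ a e {σ} → let α = grp 1 a in
  σ ∈ seqs (length α) (upTo (length α)) → weights (sortDesc α) σ ≡ α →
  + coeffK (map (columnElt α) σ) e ≡
  ∑ (seqs (suc (length a)) (one-to (length e))) (λ y →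
    ∑ (seqs (length a) bits) (λ b →
      sign (excess a b) * (ι (blocks (sortDesc α) σ == grp 1 (a ∩ b)) * ι (headAdj b y)))
    * ι (isMonomial e (map (_, 1) y)))
expand-coeffK a e {[]} σ∈ wσ = contradiction (sym wσ) (grp≢[] 1 a)
expand-coeffK a e {i ∷ σ} σ∈ wσ = begin
  + coeffK (map (columnElt α) (i ∷ σ)) e
    ≡⟨ +-coeffK pos e (All.map ∈-upTo⁻ (proj₂ (∈-seqs⁻ (length α) σ∈))) lenσ wσ ⟩
  ∑ X (λ x → ∑ (seqs (ones a) X) (λ fs → ι (adjB ss x fs) * ι (isMonomial e (zip (x ∷ fs) α))))
    ≡⟨ ∑-cong-∈ X (λ x x∈ → sym (collapse (one-to-unique (length e)) (isMonomial e) (isMonomial-additive e) a ss 1 x∈ len-ss)) ⟩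
  ∑ X (λ x → ∑ (seqs (length a) X) (λ xs → ι (adjRef a ss x xs) * ι (isMonomial e (map (_, 1) (x ∷ xs)))))
    ≡⟨ ∑-cong X (λ x → ∑-cong-∈ (seqs (length a) X) (λ xs xs∈ →
         cong (_* ι (isMonomial e (map (_, 1) (x ∷ xs)))) (sym (signed x xs (proj₁ (∈-seqs⁻ (length a) xs∈)))))) ⟩
  ∑ X (λ x → ∑ (seqs (length a) X) (λ xs → G (x ∷ xs)))
    ≡⟨ sym (∑-seqs (length a) X G) ⟩
  ∑ (seqs (suc (length a)) X) G ∎
  where
  open ≡-Reasoning
  α  = grp 1 a
  X  = one-to (length e)
  ss = strict i σ
  pos : All (1 ≤_) α
  pos = grp-positive 1 a (s≤s z≤n)
  lenσ : length σ ≡ ones a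
  lenσ = ℕ.suc-injective (≡.trans (proj₁ (∈-seqs⁻ (length α) σ∈)) (length-grp 1 a))
  len-ss : length ss ≡ ones a
  len-ss = ≡.trans (length-strict i σ) lenσ
  D : List Bool → Bool
  D b = blocks (sortDesc α) (i ∷ σ) == grp 1 (a ∩ b)
  G : List ℕ → ℤ
  G y = ∑ (seqs (length a) bits) (λ b → sign (excess a b) * (ι (D b) * ι (headAdj b y)))
        * ι (isMonomial e (map (_, 1) y))
  D-eqB : ∀ {b} → length b ≡ length a → D b ≡ eqB (ref a ss) (a ∩ b)
  -- At the start no part of the first run is finished, and one unit of its first part has been
  -- read: `k` is 0 and `c` is 1.
  D-eqB {b} len = ≡.trans (cong (_== grp 1 (a ∩ b)) (blocks-strict (sortDesc α) a 0 1 i σ (sym wσ)))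
    (grp-== 1 (ref a ss) (a ∩ b) (≡.trans (ref-length a ss) (sym (∩-length a b len))))
  signed : ∀ x xs → length xs ≡ length a →
    ∑ (seqs (length a) bits) (λ b → sign (excess a b) * (ι (D b) * ι (adjB b x xs))) ≡ ι (adjRef a ss x xs)
  signed x xs len = ≡.trans
    (∑-cong-∈ (seqs (length a) bits) (λ b b∈ →
      cong (λ t → sign (excess a b) * (ι t * ι (adjB b x xs))) (D-eqB (proj₁ (∈-seqs⁻ (length a) b∈)))))
    (signed-sum a ss x xs len-ss len)

coeffK-[] : ∀ e → coeffK [] e ≡ coeffF [] e
coeffK-[] e with isMonomial e []
... | true  = refl
... | false = refl

coeffP-grp : ∀ a e → let α = grp 1 a in
  + coeffP α e ≡ ∑ (compositions (suc (length a)))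
    (λ β → sign (length β ∸ length (join α β)) * (+ Q α (join α β) * + coeffF β e))
coeffP-grp a e = begin
  + coeffP α e
    ≡⟨ +-coeffP pos e ⟩
  ∑ S (λ σ → ι (valid σ) * + coeffK (map (columnElt α) σ) e)
    -- The expansion of `coeffK` requires the weights along the chain to spell α, which is known
    -- only where the indicator is 1.
    ≡⟨ ∑-cong-∈ S (λ σ σ∈ → ι-*-cong (valid σ) (λ v → expand-coeffK a e σ∈
         (==-sound _ _ (proj₂ (∧-true⁻ {isPerm (length α) σ} v))))) ⟩
  ∑ S (λ σ → ι (valid σ) * ∑ Y (λ y → ∑ bs (λ b →
    sign (excess a b) * (ι (blocks (sortDesc α) σ == grp 1 (a ∩ b)) * ι (headAdj b y))) * mono y))
    ≡⟨ sym (∑-rearrange S bs Y (λ b → sign (excess a b)) (λ σ → ι (valid σ))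
         (λ σ b → ι (blocks (sortDesc α) σ == grp 1 (a ∩ b))) (λ b y → ι (headAdj b y)) mono) ⟩
  ∑ bs (λ b → sign (excess a b) * (∑ S (λ σ → ι (valid σ) * ι (blocks (sortDesc α) σ == grp 1 (a ∩ b)))
                                   * ∑ Y (λ y → ι (headAdj b y) * mono y)))
    ≡⟨ ∑-cong-∈ bs (λ b b∈ → sym (term-grp b (proj₁ (∈-seqs⁻ (length a) b∈)))) ⟩
  ∑ bs (λ b → term (grp 1 b))
    ≡⟨ sym (∑-map (grp 1) bs term) ⟩
  ∑ (map (grp 1) bs) term
    ≡⟨ sym (∑-↭ (compositions-↭ (length a)) term) ⟩
  ∑ (compositions (suc (length a))) term ∎
  where
  open ≡-Reasoning
  α  = grp 1 a
  pos = grp-positive 1 a (s≤s z≤n)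
  S  = seqs (length α) (upTo (length α))
  Y  = seqs (suc (length a)) (one-to (length e))
  bs = seqs (length a) bits
  valid : List ℕ → Bool
  valid σ = isPerm (length α) σ ∧ (weights (sortDesc α) σ == α)
  mono : List ℕ → ℤ
  mono y = ι (isMonomial e (map (_, 1) y))
  term : List ℕ → ℤ
  term β = sign (length β ∸ length (join α β)) * (+ Q α (join α β) * + coeffF β e)
  term-grp : ∀ b → length b ≡ length a →
    term (grp 1 b) ≡ sign (excess a b) * (∑ S (λ σ → ι (valid σ) * ι (blocks (sortDesc α) σ == grp 1 (a ∩ b)))
                                       * ∑ Y (λ y → ι (headAdj b y) * mono y))
  term-grp b len rewrite join-grp a b len =
    cong₂ (λ k z → sign k * z) (length-∸-grp a b len)
      (cong₂ _*_ (+-Q pos (grp≢[] 1 a) (grp 1 (a ∩ b))) (+-coeffF b len e))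

theorem5p11 : (n : ℕ) (α : List ℕ) → IsComposition n α →
    (e : List ℕ) →
    + coeffP α e ≡
    sumℤ (map (λ β → sign (length β ∸ length (join α β))
    * (+ (Q α (join α β)) * + coeffF β e))
    (compositions n))
-- Only the empty β occurs and the empty matrix makes 𝒬 equal to 1, so both sides reduce to the same
-- constant power series; the chain only removes the units left by the one-term sums.
theorem5p11 zero    []      _ e = begin
  + (k + 0)               ≡⟨ cong +_ (ℕ.+-identityʳ k) ⟩
  + k                     ≡⟨ sym (ℤ.*-identityˡ (+ k)) ⟩
  + 1 * + k               ≡⟨ sym (ℤ.*-identityˡ (+ 1 * + k)) ⟩
  + 1 * (+ 1 * + k)       ≡⟨ sym (ℤ.+-identityʳ _) ⟩
  + 1 * (+ 1 * + k) +ᶻ + 0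
    ≡⟨ cong (λ l → + 1 * (+ 1 * + l) +ᶻ + 0) (coeffK-[] e) ⟩
  + 1 * (+ 1 * + coeffF [] e) +ᶻ + 0 ∎
  where
  open ≡-Reasoning
  k = coeffK [] e
theorem5p11 zero    (zero  ∷ α) (() ∷ _ , _) e
theorem5p11 zero    (suc _ ∷ α) (_ , ()) e
theorem5p11 (suc m) α       comp e with composition⇒grp comp
... | a , refl , refl = coeffP-grp a e
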